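{- For all integers $n\geq 0$ and each $r\in\{14,34,74,94\}$, we have \[ \mathcal{EO}_u(100n+r)\equiv 0 \pmod{32}. \]
   Context: For a positive integer $k$, let $f_k:=(q^k;q^k)_\infty=\prod_{i=1}^\infty(1-q^{ki})$. The integers $\mathcal{EO}_u(n)$, $n\ge 0$, are defined by $\sum_{n=0}^\infty \mathcal{EO}_u(n)q^n=\dfrac{f_4^2}{f_2^2}$. -}

module Defs where

open import Data.Nat.Base as ℕ using (ℕ; zero; suc; NonZero; _≡ᵇ_; s≤s)
import Data.Nat.Properties as ℕ
open import Data.Integer.Base using (ℤ; 0ℤ; 1ℤ; _+_; _-_; _*_)
import Data.Integer.Properties as ℤ
open import Algebra.Bundles using (CommutativeRing)
open import Algebra.Properties.Monoid.Sum ℤ.+-0-monoid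
  using (sum⁺-syntax; sum; sum-cong-≗; sum-replicate-zero)
open import Algebra.Properties.AbelianGroup
  (CommutativeRing.+-abelianGroup ℤ.+-*-commutativeRing) using (xyx⁻¹≈y)
open import Data.Bool.Base using (true; false; T; if_then_else_)
open import Data.Empty using (⊥-elim)
open import Data.Fin.Base using (toℕ)
import Data.Fin.Properties as Fin
open import Data.Unit.Base using (tt)
open import Relation.Binary.PropositionalEquality

-- A formal power series in q with integer coefficients: a n is the
-- coefficient of qⁿ.  Equality of series is pointwise (_≗_).
Series : Set
Series = ℕ → ℤ

infixl 7 _⊛_ _⊘_
infixr 8 _²

_⊛_ : Series → Series → Series
(a ⊛ b) n = ∑[ i ≤ n ] (a (toℕ i) * b (n ℕ.∸ toℕ i))

_² : Series → Series
a ² = a ⊛ a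

-- Long division.  It assumes that b has constant term 1; under that
-- hypothesis a ⊘ b is the quotient a / b (see ⊘-⊛ below).
_⊘_ : Series → Series → Series
(a ⊘ b) zero    = a zero
(a ⊘ b) (suc n) = ((λ m → a (suc m) - a zero * b (suc m)) ⊘ b) n

q^_ : ℕ → Series
(q^ m) n = if m ≡ᵇ n then 1ℤ else 0ℤ

1-q^_ : ℕ → Series
(1-q^ m) n = (q^ 0) n - (q^ m) n

-- (qᵏ;qᵏ)_N, the product of the factors 1 - q^(k i) for 1 ≤ i ≤ N.
partialProduct : ℕ → ℕ → Series
partialProduct k zero    = q^ 0
partialProduct k (suc N) = (1-q^ (k ℕ.* suc N)) ⊛ partialProduct k N

-- (qᵏ;qᵏ)_∞.  The coefficient of qⁿ is the same in all partial products
-- with at least n factors (see f-limit below), so the limit of the partial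
-- products is read off along the diagonal.
f : (k : ℕ) .{{_ : NonZero k}} → Series
f k n = partialProduct k n n

EOᵤ : ℕ → ℤ
EOᵤ = f 4 ² ⊘ f 2 ²

------------------------------------------------------------------------
-- The definitions above have the intended meaning

⊘-⊛ : ∀ a b → b 0 ≡ 1ℤ → (a ⊘ b) ⊛ b ≗ a
⊘-⊛ a b b₀≡1 zero = begin
  a 0 * b 0 + 0ℤ  ≡⟨ ℤ.+-identityʳ _ ⟩
  a 0 * b 0       ≡⟨ cong (a 0 *_) b₀≡1 ⟩
  a 0 * 1ℤ        ≡⟨ ℤ.*-identityʳ _ ⟩
  a 0             ∎
  where open ≡-Reasoning
⊘-⊛ a b b₀≡1 (suc n) = begin
  x + (rest ⊘ b ⊛ b) n     ≡⟨ cong (x +_) (⊘-⊛ rest b b₀≡1 n) ⟩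
  x + (a (suc n) - x)      ≡⟨ ℤ.+-assoc x (a (suc n)) _ ⟨
  x + a (suc n) - x        ≡⟨ xyx⁻¹≈y x (a (suc n)) ⟩
  a (suc n)                ∎
  where
  open ≡-Reasoning
  x = a 0 * b (suc n)
  rest : Series
  rest m = a (suc m) - a 0 * b (suc m)

q^-off-diagonal : ∀ {m n} → n ℕ.< m → (q^ m) n ≡ 0ℤ
q^-off-diagonal {m} {n} n<m with m ≡ᵇ n in eq
... | false = refl
... | true  = ⊥-elim (ℕ.<⇒≢ n<m (sym (ℕ.≡ᵇ⇒≡ m n (subst T (sym eq) tt))))

1-q^-⊛ : ∀ {m n} (a : Series) → n ℕ.< m → ((1-q^ m) ⊛ a) n ≡ a n
1-q^-⊛ {m} {n} a n<m = begin
  (1-q^ m) 0 * a n + sum {n} (λ i → (1-q^ m) (suc (toℕ i)) * a (n ℕ.∸ suc (toℕ i)))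
    ≡⟨ cong₂ (λ c s → (1ℤ - c) * a n + s)
         (q^-off-diagonal (ℕ.≤-<-trans ℕ.z≤n n<m))
         (trans (sum-cong-≗ {n} (λ i →
                   cong (λ c → (0ℤ - c) * a (n ℕ.∸ suc (toℕ i)))
                        (q^-off-diagonal (ℕ.≤-<-trans (Fin.toℕ<n i) n<m))))
                (sum-replicate-zero n)) ⟩
  1ℤ * a n + 0ℤ  ≡⟨ ℤ.+-identityʳ _ ⟩
  1ℤ * a n       ≡⟨ ℤ.*-identityˡ _ ⟩
  a n            ∎
  where open ≡-Reasoning

f-limit : ∀ k .{{_ : NonZero k}} {n N} → n ℕ.≤ N → partialProduct k N n ≡ f k n
f-limit k n≤N = go (ℕ.≤⇒≤′ n≤N)
  where
  go : ∀ {n N} → n ℕ.≤′ N → partialProduct k N n ≡ f k n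
  go (ℕ.≤′-reflexive refl)       = refl
  go {n} {suc N} (ℕ.≤′-step n≤N) =
    trans (1-q^-⊛ (partialProduct k N)
                  (ℕ.<-≤-trans (s≤s (ℕ.≤′⇒≤ n≤N)) (ℕ.m≤n*m (suc N) k)))
          (go n≤N)

EOᵤ-defining : EOᵤ ⊛ f 2 ² ≗ f 4 ²
EOᵤ-defining = ⊘-⊛ (f 4 ²) (f 2 ²) refl

{-# OPTIONS --safe #-}

-- Write x = q², y = q⁴, P = ∏ (1 - yⁱ) = f₄ and N = ∏ (1 + yⁱ).  Gauss's identity
-- for φ(x) = Σ x^(n²), taken at -x, gives EOᵤ · P = N² φ(x).  From
-- (1 + z)² = (1 - z)² (1 + 4 z / (1 - z)²) one gets N² = P² Q with
-- Q ≡ 1 + 4 Σ yⁱ / (1 - yⁱ)² mod 16.  By the symmetry of the Lambert double sum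
-- this is Q ≡ 1 + 4 Σ i yⁱ / (1 - yⁱ), that is P Q ≡ P - θ P mod 16 with
-- θ = q d/dq.  Hence, with φ = 1 + 2 g,
--
--   EOᵤ = φ P Q ≡ P Q + 2 g (P - θ P)   mod 32.
--
-- The first summand involves only exponents divisible by 4.  In the second, g
-- lives on the exponents 2 s² and, by the pentagonal number theorem, P and θ P
-- live on the exponents m for which 6 m + 1 is a square t², so only exponents n
-- with 6 n + 1 = t² + 12 s² occur; that is impossible modulo 25.
--
-- Infinite series are replaced by their truncations below a degree K: modulo
-- q^K the products are finite and qᵏ (k ≥ 1) is nilpotent, so that everything
-- but the support arguments is algebra in a commutative ring.

module Submission where

open import Defs
open import Data.Nat.Base using (ℕ; _+_; _*_)
open import Data.Integer.Base using (+_)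
open import Data.Integer.Divisibility using (_∣_)
open import Data.List.Base using ([]; _∷_)
open import Data.List.Membership.Propositional using (_∈_)

open import Algebra.Bundles using (CommutativeRing)
import Algebra.Properties.CommutativeSemiring.Exp
import Algebra.Properties.Semiring.Exp
import Algebra.Solver.Ring
open import Algebra.Solver.Ring.AlmostCommutativeRing
  using (fromCommutativeRing; _-Raw-AlmostCommutative⟶_)
open import Algebra.Structures using (IsCommutativeRing)
open import Data.Empty using (⊥)
open import Data.Fin.Base using (Fin; toℕ; fromℕ<)
import Data.Fin.Properties as Fin
open import Data.Integer.Base as ℤ using (ℤ; 0ℤ; 1ℤ)
import Data.Integer.Properties as ℤ
import Data.Integer.Solver
open import Data.List.Base using (List)
open import Data.List.Membership.Propositional using (_∉_)
open import Data.List.Relation.Unary.All using (All; all?; lookup)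
open import Data.Maybe.Base using (Maybe; map)
open import Data.Nat.Base as ℕ using (zero; suc; _∸_; _≤_; _<_; z≤n; s≤s)
import Data.Nat.Divisibility as ℕ
open import Data.Nat.DivMod using (_%_; m%n<n; %-distribˡ-+; %-distribˡ-*; [m+kn]%n≡m%n)
import Data.Nat.Properties as ℕ
import Data.Nat.Solver
open import Data.Product.Base using (∃-syntax; _×_; _,_; proj₁; proj₂)
open import Data.Sum.Base using (_⊎_; inj₁; inj₂; map₁; map₂; fromInj₂)
open import Level using (0ℓ)
open import Relation.Binary.PropositionalEquality
  using (_≡_; _≢_; _≗_; refl; sym; trans; cong; cong₂; subst; subst₂; module ≡-Reasoning)
open import Relation.Nullary.Decidable using (toWitness; ¬?; dec⇒maybe)
open import Relation.Nullary.Negation.Core using (¬_; contradiction)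
open import Data.List.Membership.DecPropositional ℕ._≟_ using (_∈?_)

module ℕ-Solver = Data.Nat.Solver.+-*-Solver
module ℤ-Solver = Data.Integer.Solver.+-*-Solver

-- Identities in an arbitrary commutative ring.

module RingIdentities (R : CommutativeRing 0ℓ 0ℓ)
  (hom : CommutativeRing.rawRing ℤ.+-*-commutativeRing
         -Raw-AlmostCommutative⟶ fromCommutativeRing R) where

  open CommutativeRing R
    using (Carrier; _≈_; 0#; 1#; semiring; commutativeSemiring; setoid; +-cong; +-congˡ; +-congʳ;
           *-cong; *-congˡ; *-congʳ; -‿cong; *-identityˡ; *-identityʳ; +-identityʳ; +-identityˡ)
    renaming (_+_ to _⊕_; _*_ to _⊗_; _-_ to _⊖_; -_ to ⊝_;
              refl to ≈-refl; reflexive to ≈-reflexive; sym to ≈-sym; trans to ≈-trans)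
  open _-Raw-AlmostCommutative⟶_ hom
  open Algebra.Properties.Semiring.Exp semiring public
  open Algebra.Properties.CommutativeSemiring.Exp commutativeSemiring using (^-distrib-*)
  open import Relation.Binary.Reasoning.Setoid setoid

  -- The given homomorphism, adjusted so that 0 and 1 go to 0# and 1# on the
  -- nose: the solver then accepts goals in which these occur.
  κ : ℤ → Carrier
  κ (+ 0) = 0#
  κ (+ 1) = 1#
  κ c     = ⟦ c ⟧

  κ≈⟦⟧ : ∀ c → κ c ≈ ⟦ c ⟧
  κ≈⟦⟧ (+ 0)           = ≈-sym 0-homo
  κ≈⟦⟧ (+ 1)           = ≈-sym 1-homo
  κ≈⟦⟧ (+ suc (suc _)) = ≈-refl
  κ≈⟦⟧ ℤ.-[1+ _ ]      = ≈-refl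

  κ-hom : CommutativeRing.rawRing ℤ.+-*-commutativeRing
          -Raw-AlmostCommutative⟶ fromCommutativeRing R
  κ-hom = record
    { ⟦_⟧    = κ
    ; +-homo = λ c d → ≈-trans (κ≈⟦⟧ (c ℤ.+ d)) (≈-trans (+-homo c d)
                 (≈-sym (+-cong (κ≈⟦⟧ c) (κ≈⟦⟧ d))))
    ; *-homo = λ c d → ≈-trans (κ≈⟦⟧ (c ℤ.* d)) (≈-trans (*-homo c d)
                 (≈-sym (*-cong (κ≈⟦⟧ c) (κ≈⟦⟧ d))))
    ; -‿homo = λ c → ≈-trans (κ≈⟦⟧ (ℤ.- c)) (≈-trans (-‿homo c) (≈-sym (-‿cong (κ≈⟦⟧ c))))
    ; 0-homo = ≈-refl
    ; 1-homo = ≈-refl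
    }

  _κ≟_ : ∀ c d → Maybe (κ c ≈ κ d)
  c κ≟ d = map (λ c≡d → ≈-reflexive (cong κ c≡d)) (dec⇒maybe (c ℤ.≟ d))

  open Algebra.Solver.Ring (CommutativeRing.rawRing ℤ.+-*-commutativeRing)
    (fromCommutativeRing R) κ-hom _κ≟_
    using (solve; _:=_; _:+_; _:*_; _:-_; :-_; con)

  -- Finite products and sums.

  ∏ : (ℕ → Carrier) → ℕ → Carrier
  ∏ t zero    = 1#
  ∏ t (suc n) = t n ⊗ ∏ t n

  ∑ : (ℕ → Carrier) → ℕ → Carrier
  ∑ t zero    = 0#
  ∑ t (suc n) = t n ⊕ ∑ t n

  ∏-cong : ∀ {t u} → (∀ i → t i ≈ u i) → ∀ n → ∏ t n ≈ ∏ u n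
  ∏-cong t≈u zero    = ≈-refl
  ∏-cong t≈u (suc n) = *-cong (t≈u n) (∏-cong t≈u n)

  ∏-* : ∀ t u n → ∏ (λ i → t i ⊗ u i) n ≈ ∏ t n ⊗ ∏ u n
  ∏-* t u zero    = ≈-sym (*-identityˡ _)
  ∏-* t u (suc n) = ≈-trans (*-congˡ (∏-* t u n))
    (solve 4 (λ a b c d → a :* b :* (c :* d) := a :* c :* (b :* d)) ≈-refl _ _ _ _)

  ∏-first : ∀ t n → ∏ t (suc n) ≈ t 0 ⊗ ∏ (λ i → t (suc i)) n
  ∏-first t zero    = ≈-refl
  ∏-first t (suc n) = ≈-trans (*-congˡ (∏-first t n))
    (solve 3 (λ a b c → a :* (b :* c) := b :* (a :* c)) ≈-refl _ _ _)

  ∏-alternate : ∀ t n → ∏ t (n * 2) ≈ ∏ (λ i → t (i * 2)) n ⊗ ∏ (λ i → t (suc (i * 2))) n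
  ∏-alternate t zero    = ≈-sym (*-identityˡ _)
  ∏-alternate t (suc n) = ≈-trans (*-congˡ (*-congˡ (∏-alternate t n)))
    (solve 4 (λ a b c d → a :* (b :* (c :* d)) := b :* c :* (a :* d)) ≈-refl _ _ _ _)

  ∑-cong : ∀ {t u} → (∀ i → t i ≈ u i) → ∀ n → ∑ t n ≈ ∑ u n
  ∑-cong t≈u zero    = ≈-refl
  ∑-cong t≈u (suc n) = +-cong (t≈u n) (∑-cong t≈u n)

  ∑-zero : ∀ n → ∑ (λ _ → 0#) n ≈ 0#
  ∑-zero zero    = ≈-refl
  ∑-zero (suc n) = ≈-trans (+-identityˡ _) (∑-zero n)

  ∑-+ : ∀ t u n → ∑ (λ i → t i ⊕ u i) n ≈ ∑ t n ⊕ ∑ u n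
  ∑-+ t u zero    = ≈-sym (+-identityˡ _)
  ∑-+ t u (suc n) = ≈-trans (+-congˡ (∑-+ t u n))
    (solve 4 (λ a b c d → a :+ b :+ (c :+ d) := a :+ c :+ (b :+ d)) ≈-refl _ _ _ _)

  ∑-swap : ∀ (t : ℕ → ℕ → Carrier) m n →
           ∑ (λ i → ∑ (t i) n) m ≈ ∑ (λ j → ∑ (λ i → t i j) m) n
  ∑-swap t zero    n = ≈-sym (∑-zero n)
  ∑-swap t (suc m) n = ≈-trans (+-congˡ (∑-swap t m n))
    (≈-sym (∑-+ (t m) (λ j → ∑ (λ i → t i j) m) n))

  ∑-first : ∀ t n → (∀ i → t (suc i) ≈ 0#) → ∑ t (suc n) ≈ t 0
  ∑-first t zero    _   = +-identityʳ _
  ∑-first t (suc n) t≈0 = ≈-trans (+-cong (t≈0 n) (∑-first t n t≈0)) (+-identityˡ _)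

  -- Shanks's finite identities and Gauss's theta series.

  factors⁻ factors⁺ : Carrier → ℕ → Carrier
  factors⁻ x i = 1# ⊖ x ^ suc i
  factors⁺ x i = 1# ⊕ x ^ suc i

  -- Generalises both identities of Shanks: α = 0 gives his form of the
  -- pentagonal number theorem, α = 1 the one for Σ (-1)ⁿ x^(n²).
  module Shanks (α x : Carrier) where

    -- In closed form: (-x)^s times the product of the α + x^i over i < s.
    w : ℕ → Carrier
    w zero    = 1#
    w (suc s) = ⊝ (w s ⊗ (x ^ s ⊕ α) ⊗ x)

    -- For s ≤ n, `D s (n ∸ s)` is the quotient (x;x)_n / (x;x)_s, written without division.
    D : ℕ → ℕ → Carrier
    D s = ∏ (λ i → 1# ⊖ x ^ suc (s + i))

    term : ℕ → ℕ → Carrier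
    term n s = w s ⊗ D s (n ∸ s) ⊗ (x ^ n) ^ s

    E : ℕ → Carrier
    E n = ∑ (term n) (suc n)

    D-last : ∀ {n s} → s ≤ n → D s (suc n ∸ s) ≈ (1# ⊖ x ^ suc n) ⊗ D s (n ∸ s)
    D-last {n} {s} s≤n rewrite ℕ.+-∸-assoc 1 s≤n | ℕ.m+[n∸m]≡n s≤n = ≈-refl

    D-first : ∀ {n s} → s < n → D s (n ∸ s) ≈ (1# ⊖ x ^ suc s) ⊗ D (suc s) (n ∸ suc s)
    D-first {n} {s} s<n rewrite ℕ.+-∸-assoc 1 s<n = ≈-trans (∏-first _ (n ∸ suc s))
      (*-cong (factor (ℕ.+-identityʳ s)) (∏-cong (λ i → factor (ℕ.+-suc s i)) (n ∸ suc s)))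
      where
      factor : ∀ {i j} → i ≡ j → 1# ⊖ x ^ suc i ≈ 1# ⊖ x ^ suc j
      factor refl = ≈-refl

    -- Telescoping in s. With y = x^(s+1), the induction step rests on y (1 - x^(n+1)) + (1 - y) =
    -- (1 + α x^(n+1)) - x^(n+1) (y + α): the first summand comes from the new term, the second from
    -- the old remainder, and -x (y + α) is the factor that leads from `w (suc s)` to
    -- `w (suc (suc s))`.
    partial-sum : ∀ n s → s ≤ n →
      ∑ (term (suc n)) (suc s) ≈
      (1# ⊕ α ⊗ x ^ suc n) ⊗ ∑ (term n) (suc s) ⊕ w (suc s) ⊗ D s (n ∸ s) ⊗ (x ^ n) ^ suc s
    partial-sum n zero _ = solve 4 (λ α x z d →
        con 1ℤ :* ((con 1ℤ :- x :* z) :* d) :* con 1ℤ :+ con 0ℤ :=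
        (con 1ℤ :+ α :* (x :* z)) :* (con 1ℤ :* d :* con 1ℤ :+ con 0ℤ) :+
        (:- (con 1ℤ :* (con 1ℤ :+ α) :* x)) :* d :* (z :* con 1ℤ))
      ≈-refl α x (x ^ n) (D 0 n)
    partial-sum n (suc s) s<n = begin
      term (suc n) (suc s) ⊕ ∑ (term (suc n)) (suc s)
        ≈⟨ +-cong (*-cong (*-congˡ (D-last s<n)) (^-distrib-* x (x ^ n) (suc s)))
                  (partial-sum n s (ℕ.<⇒≤ s<n)) ⟩
      w (suc s) ⊗ ((1# ⊖ x ⊗ x ^ n) ⊗ d) ⊗ (x ^ suc s ⊗ p) ⊕
        ((1# ⊕ α ⊗ (x ⊗ x ^ n)) ⊗ ∑ (term n) (suc s) ⊕ w (suc s) ⊗ D s (n ∸ s) ⊗ p)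
        ≈⟨ +-congˡ (+-congˡ (*-congʳ (*-congˡ (D-first s<n)))) ⟩
      w (suc s) ⊗ ((1# ⊖ x ⊗ x ^ n) ⊗ d) ⊗ (x ^ suc s ⊗ p) ⊕
        ((1# ⊕ α ⊗ (x ⊗ x ^ n)) ⊗ ∑ (term n) (suc s) ⊕
         w (suc s) ⊗ ((1# ⊖ x ^ suc s) ⊗ d) ⊗ p)
        ≈⟨ solve 8 (λ α x z w d y p t →
             w :* ((con 1ℤ :- x :* z) :* d) :* (y :* p) :+
             ((con 1ℤ :+ α :* (x :* z)) :* t :+ w :* ((con 1ℤ :- y) :* d) :* p) :=
             (con 1ℤ :+ α :* (x :* z)) :* (w :* d :* p :+ t) :+
             (:- (w :* (y :+ α) :* x)) :* d :* (z :* p))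
           ≈-refl α x (x ^ n) (w (suc s)) d (x ^ suc s) p (∑ (term n) (suc s)) ⟩
      (1# ⊕ α ⊗ x ^ suc n) ⊗ ∑ (term n) (suc (suc s)) ⊕ w (suc (suc s)) ⊗ d ⊗ (x ^ n ⊗ p) ∎
      where
      d = D (suc s) (n ∸ suc s)
      p = (x ^ n) ^ suc s

    E-zero : E 0 ≈ 1#
    E-zero = solve 0 (con 1ℤ :* con 1ℤ :* con 1ℤ :+ con 0ℤ := con 1ℤ) ≈-refl

    -- The case s = n of `partial-sum`, together with the last term of `E (suc n)`. For α = 0 the
    -- increment consists of just two monomials, which is why the resulting series is sparse.
    E-suc : ∀ n → E (suc n) ≈
      (1# ⊕ α ⊗ x ^ suc n) ⊗ E n ⊕ w (suc n) ⊗ (x ^ n) ^ suc n ⊗ (1# ⊕ x ^ suc n)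
    E-suc n = ≈-trans
      (+-cong (*-cong (*-congˡ (D-empty n {suc n})) (^-distrib-* x (x ^ n) (suc n)))
              (≈-trans (partial-sum n n ℕ.≤-refl) (+-congˡ (*-congʳ (*-congˡ (D-empty n {n}))))))
      (solve 4 (λ w y p t →
          w :* con 1ℤ :* (y :* p) :+ (t :+ w :* con 1ℤ :* p) := t :+ w :* p :* (con 1ℤ :+ y))
        ≈-refl (w (suc n)) (x ^ suc n) ((x ^ n) ^ suc n) _)
      where
      D-empty : ∀ n {s} → D s (n ∸ n) ≈ 1#
      D-empty n rewrite ℕ.n∸n≡0 n = ≈-refl

    -- Every summand with s ≥ 1 contains the factor x^n; the one with s = 0 is the whole product.
    E≈∏ : ∀ n → x ^ n ≈ 0# → E n ≈ ∏ (factors⁻ x) n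
    E≈∏ n xⁿ≈0 = ≈-trans
      (∑-first (term n) n λ s → ≈-trans (*-congˡ (*-congʳ xⁿ≈0))
        (solve 2 (λ a b → a :* (con 0ℤ :* b) := con 0ℤ) ≈-refl _ _))
      (solve 1 (λ d → con 1ℤ :* d :* con 1ℤ := d) ≈-refl _)

  -- The sum of (-1)^m x^(m²) over 1 ≤ m ≤ n, with m² split as m + (m - 1) m to match the increments
  -- in `E-suc`.
  gaussTail : Carrier → ℕ → Carrier
  gaussTail x = ∑ (λ i → (⊝ x) ^ suc i ⊗ (x ^ i) ^ suc i)

  -- The case α = 1: both parts of the recursion `E-suc` then carry the product of the 1 + x^i, so
  -- it factors out and leaves the partial sums of the theta series.
  gauss : ∀ x n → x ^ n ≈ 0# →
          ∏ (factors⁺ x) n ⊗ (1# ⊕ κ (+ 2) ⊗ gaussTail x n) ≈ ∏ (factors⁻ x) n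
  gauss x n xⁿ≈0 = ≈-trans (≈-sym (E≈ n)) (E≈∏ n xⁿ≈0)
    where
    open Shanks (1#) x
    -- The coefficient 2 is the factor 1 + x^0 in the closed form of `w`.
    w≈ : ∀ s → w s ⊗ (x ^ s ⊕ 1#) ≈ κ (+ 2) ⊗ (⊝ x) ^ s ⊗ ∏ (factors⁺ x) s
    w≈ zero    = solve 0 (con 1ℤ :* (con 1ℤ :+ con 1ℤ) := con (+ 2) :* con 1ℤ :* con 1ℤ) ≈-refl
    w≈ (suc s) = ≈-trans (*-congʳ (-‿cong (*-congʳ (w≈ s))))
      (solve 4 (λ x y m p →
          (:- (con (+ 2) :* m :* p :* x)) :* (y :+ con 1ℤ) :=
          con (+ 2) :* ((:- x) :* m) :* ((con 1ℤ :+ y) :* p))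
        ≈-refl x (x ^ suc s) ((⊝ x) ^ s) (∏ (factors⁺ x) s))
    E≈ : ∀ n → E n ≈ ∏ (factors⁺ x) n ⊗ (1# ⊕ κ (+ 2) ⊗ gaussTail x n)
    E≈ zero    = solve 0 (con 1ℤ :* con 1ℤ :* con 1ℤ :+ con 0ℤ :=
                          con 1ℤ :* (con 1ℤ :+ con (+ 2) :* con 0ℤ)) ≈-refl
    E≈ (suc n) = begin
      E (suc n)
        ≈⟨ E-suc n ⟩
      (1# ⊕ 1# ⊗ x ^ suc n) ⊗ E n ⊕ w (suc n) ⊗ p ⊗ (1# ⊕ x ^ suc n)
        ≈⟨ +-cong (*-congˡ (E≈ n))
             (≈-trans (solve 3 (λ w p y → w :* p :* (con 1ℤ :+ y) := w :* (y :+ con 1ℤ) :* p)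
                         ≈-refl (w (suc n)) p (x ^ suc n))
                      (*-congʳ (w≈ (suc n)))) ⟩
      (1# ⊕ 1# ⊗ x ^ suc n) ⊗ (N ⊗ (1# ⊕ κ (+ 2) ⊗ g)) ⊕
        κ (+ 2) ⊗ (⊝ x) ^ suc n ⊗ ((1# ⊕ x ^ suc n) ⊗ N) ⊗ p
        ≈⟨ solve 5 (λ y N g m p →
             (con 1ℤ :+ con 1ℤ :* y) :* (N :* (con 1ℤ :+ con (+ 2) :* g)) :+
             con (+ 2) :* m :* ((con 1ℤ :+ y) :* N) :* p :=
             (con 1ℤ :+ y) :* N :* (con 1ℤ :+ con (+ 2) :* (m :* p :+ g)))
           ≈-refl (x ^ suc n) N g ((⊝ x) ^ suc n) p ⟩
      ∏ (factors⁺ x) (suc n) ⊗ (1# ⊕ κ (+ 2) ⊗ gaussTail x (suc n)) ∎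
      where
      p = (x ^ n) ^ suc n
      N = ∏ (factors⁺ x) n
      g = gaussTail x n

  -- Geometric sums, Lambert series and the logarithmic derivative.

  κ-suc : ∀ k → κ (+ suc k) ≈ 1# ⊕ κ (+ k)
  κ-suc k = _-Raw-AlmostCommutative⟶_.+-homo κ-hom 1ℤ (+ k)

  -- The exact finite sum leaves the remainder c z^(n+1), which nilpotency kills. This expresses c z
  -- / (1 - z) without inverses; `geometric′` treats z / (1 - z)² in the same way.
  geometric : ∀ c z n → z ^ suc n ≈ 0# → (1# ⊖ z) ⊗ ∑ (λ k → c ⊗ z ^ suc k) n ≈ c ⊗ z
  geometric c z n z≈0 = begin
    (1# ⊖ z) ⊗ ∑ (λ k → c ⊗ z ^ suc k) n  ≈⟨ exact n ⟩
    c ⊗ z ⊖ c ⊗ z ^ suc n                 ≈⟨ +-congˡ (-‿cong (*-congˡ z≈0)) ⟩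
    c ⊗ z ⊖ c ⊗ 0#                        ≈⟨ solve 2 (λ c z → c :* z :- c :* con 0ℤ := c :* z) ≈-refl c z ⟩
    c ⊗ z                                 ∎
    where
    exact : ∀ n → (1# ⊖ z) ⊗ ∑ (λ k → c ⊗ z ^ suc k) n ≈ c ⊗ z ⊖ c ⊗ z ^ suc n
    exact zero    = solve 2 (λ c z → (con 1ℤ :- z) :* con 0ℤ := c :* z :- c :* (z :* con 1ℤ))
      ≈-refl c z
    exact (suc n) = begin
      (1# ⊖ z) ⊗ (c ⊗ p ⊕ s)
        ≈⟨ solve 4 (λ c z p s → (con 1ℤ :- z) :* (c :* p :+ s) :=
             (con 1ℤ :- z) :* s :+ (con 1ℤ :- z) :* (c :* p)) ≈-refl c z p s ⟩
      (1# ⊖ z) ⊗ s ⊕ (1# ⊖ z) ⊗ (c ⊗ p)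
        ≈⟨ +-congʳ (exact n) ⟩
      c ⊗ z ⊖ c ⊗ p ⊕ (1# ⊖ z) ⊗ (c ⊗ p)
        ≈⟨ solve 3 (λ c z p → c :* z :- c :* p :+ (con 1ℤ :- z) :* (c :* p) :=
             c :* z :- c :* (z :* p)) ≈-refl c z p ⟩
      c ⊗ z ⊖ c ⊗ z ^ suc (suc n) ∎
      where
      p = z ^ suc n
      s = ∑ (λ k → c ⊗ z ^ suc k) n

  geometric′ : ∀ z n → z ^ suc n ≈ 0# →
    (1# ⊖ z) ⊗ (1# ⊖ z) ⊗ ∑ (λ k → κ (+ suc k) ⊗ z ^ suc k) n ≈ z
  geometric′ z n z≈0 = begin
    (1# ⊖ z) ⊗ (1# ⊖ z) ⊗ S n
      ≈⟨ exact n ⟩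
    z ⊖ κ (+ suc n) ⊗ z ^ suc n ⊕ κ (+ n) ⊗ (z ⊗ z ^ suc n)
      ≈⟨ +-cong (+-congˡ (-‿cong (*-congˡ z≈0))) (*-congˡ (*-congˡ z≈0)) ⟩
    z ⊖ κ (+ suc n) ⊗ 0# ⊕ κ (+ n) ⊗ (z ⊗ 0#)
      ≈⟨ solve 3 (λ z a b → z :- a :* con 0ℤ :+ b :* (z :* con 0ℤ) := z) ≈-refl z _ _ ⟩
    z ∎
    where
    S : ℕ → Carrier
    S = ∑ (λ k → κ (+ suc k) ⊗ z ^ suc k)
    exact : ∀ n → (1# ⊖ z) ⊗ (1# ⊖ z) ⊗ S n ≈
                  z ⊖ κ (+ suc n) ⊗ z ^ suc n ⊕ κ (+ n) ⊗ (z ⊗ z ^ suc n)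
    exact zero    = solve 1 (λ z → (con 1ℤ :- z) :* (con 1ℤ :- z) :* con 0ℤ :=
        z :- con 1ℤ :* (z :* con 1ℤ) :+ con 0ℤ :* (z :* (z :* con 1ℤ)))
      ≈-refl z
    exact (suc n) = begin
      (1# ⊖ z) ⊗ (1# ⊖ z) ⊗ (κ (+ suc n) ⊗ p ⊕ S n)
        ≈⟨ solve 4 (λ z k p s → (con 1ℤ :- z) :* (con 1ℤ :- z) :* (k :* p :+ s) :=
             (con 1ℤ :- z) :* (con 1ℤ :- z) :* s :+ (con 1ℤ :- z) :* (con 1ℤ :- z) :* (k :* p))
             ≈-refl z (κ (+ suc n)) p (S n) ⟩
      (1# ⊖ z) ⊗ (1# ⊖ z) ⊗ S n ⊕ (1# ⊖ z) ⊗ (1# ⊖ z) ⊗ (κ (+ suc n) ⊗ p)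
        ≈⟨ +-cong (exact n) (*-congˡ (*-congʳ (κ-suc n))) ⟩
      z ⊖ κ (+ suc n) ⊗ p ⊕ κ (+ n) ⊗ (z ⊗ p) ⊕ (1# ⊖ z) ⊗ (1# ⊖ z) ⊗ ((1# ⊕ κ (+ n)) ⊗ p)
        ≈⟨ +-congʳ (+-congʳ (+-congˡ (-‿cong (*-congʳ (κ-suc n))))) ⟩
      z ⊖ (1# ⊕ κ (+ n)) ⊗ p ⊕ κ (+ n) ⊗ (z ⊗ p) ⊕ (1# ⊖ z) ⊗ (1# ⊖ z) ⊗ ((1# ⊕ κ (+ n)) ⊗ p)
        ≈⟨ solve 3 (λ z k p →
             z :- (con 1ℤ :+ k) :* p :+ k :* (z :* p) :+
             (con 1ℤ :- z) :* (con 1ℤ :- z) :* ((con 1ℤ :+ k) :* p) :=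
             z :- (con 1ℤ :+ (con 1ℤ :+ k)) :* (z :* p) :+ (con 1ℤ :+ k) :* (z :* (z :* p)))
             ≈-refl z (κ (+ n)) p ⟩
      z ⊖ (1# ⊕ (1# ⊕ κ (+ n))) ⊗ (z ⊗ p) ⊕ (1# ⊕ κ (+ n)) ⊗ (z ⊗ (z ⊗ p))
        ≈⟨ +-cong (+-congˡ (-‿cong (*-congʳ (≈-trans (κ-suc (suc n)) (+-congˡ (κ-suc n))))))
                  (*-congʳ (κ-suc n)) ⟨
      z ⊖ κ (+ suc (suc n)) ⊗ (z ⊗ p) ⊕ κ (+ suc n) ⊗ (z ⊗ (z ⊗ p)) ∎
      where p = z ^ suc n

  -- On expanding, every product of two or more of the terms 4 s i is a multiple of 16, so only the
  -- linear part survives modulo 16.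
  ∏[1+4s] : ∀ (s : ℕ → Carrier) n →
            ∃[ u ] ∏ (λ i → 1# ⊕ κ (+ 4) ⊗ s i) n ≈ 1# ⊕ κ (+ 4) ⊗ ∑ s n ⊕ κ (+ 16) ⊗ u
  ∏[1+4s] s zero    = 0# ,
    solve 0 (con 1ℤ := con 1ℤ :+ con (+ 4) :* con 0ℤ :+ con (+ 16) :* con 0ℤ) ≈-refl
  ∏[1+4s] s (suc n) with ∏[1+4s] s n
  ... | u , eq = u ⊕ s n ⊗ (∑ s n ⊕ κ (+ 4) ⊗ u) , ≈-trans (*-congˡ eq)
    (solve 3 (λ a t u →
        (con 1ℤ :+ con (+ 4) :* a) :* (con 1ℤ :+ con (+ 4) :* t :+ con (+ 16) :* u) :=
        con 1ℤ :+ con (+ 4) :* (a :+ t) :+ con (+ 16) :* (u :+ a :* (t :+ con (+ 4) :* u)))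
      ≈-refl (s n) (∑ s n) u)

  -- The truncated expansions of yⁱ⁺¹ / (1 - yⁱ⁺¹)² and (i + 1) yⁱ⁺¹ / (1 - yⁱ⁺¹).
  squareLambert lambert : Carrier → ℕ → ℕ → Carrier
  squareLambert y n i = ∑ (λ k → κ (+ suc k) ⊗ (y ^ suc i) ^ suc k) n
  lambert       y n i = ∑ (λ k → κ (+ suc i) ⊗ (y ^ suc i) ^ suc k) n

  -- Interchanging i and k preserves the exponent (i + 1) (k + 1) and turns the weight k + 1 into i
  -- + 1. Both indices run below the same n, so the truncation is symmetric too.
  ∑-squareLambert : ∀ y n → ∑ (squareLambert y n) n ≈ ∑ (lambert y n) n
  ∑-squareLambert y n = ≈-trans (∑-swap _ n n) (∑-cong (λ i → ∑-cong (λ k → *-congˡ (begin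
    (y ^ suc k) ^ suc i      ≈⟨ ^-assocʳ y (suc k) (suc i) ⟩
    y ^ (suc k * suc i)      ≈⟨ ^-congʳ y (ℕ.*-comm (suc k) (suc i)) ⟩
    y ^ (suc i * suc k)      ≈⟨ ^-assocʳ y (suc i) (suc k) ⟨
    (y ^ suc i) ^ suc k      ∎)) n) n)

  -- Factor by factor, (1 + z)² = (1 - z)² + 4 z, where z is rewritten by `geometric′` as (1 - z)²
  -- times its truncated series; (1 - z)² then factors out.
  ∏-factors-square : ∀ y n → (∀ i → (y ^ suc i) ^ suc n ≈ 0#) → ∀ m →
    ∏ (factors⁺ y) m ⊗ ∏ (factors⁺ y) m ≈
    ∏ (factors⁻ y) m ⊗ ∏ (factors⁻ y) m ⊗ ∏ (λ i → 1# ⊕ κ (+ 4) ⊗ squareLambert y n i) m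
  ∏-factors-square y n y≈0 zero    = ≈-sym (*-identityʳ _)
  ∏-factors-square y n y≈0 (suc m) = begin
    (1# ⊕ z) ⊗ N ⊗ ((1# ⊕ z) ⊗ N)
      ≈⟨ solve 2 (λ z N → (con 1ℤ :+ z) :* N :* ((con 1ℤ :+ z) :* N) :=
           ((con 1ℤ :- z) :* (con 1ℤ :- z) :+ con (+ 4) :* z) :* (N :* N)) ≈-refl z N ⟩
    ((1# ⊖ z) ⊗ (1# ⊖ z) ⊕ κ (+ 4) ⊗ z) ⊗ (N ⊗ N)
      ≈⟨ *-cong (+-congˡ (*-congˡ (≈-sym (geometric′ z n (y≈0 m))))) (∏-factors-square y n y≈0 m) ⟩
    ((1# ⊖ z) ⊗ (1# ⊖ z) ⊕ κ (+ 4) ⊗ ((1# ⊖ z) ⊗ (1# ⊖ z) ⊗ s)) ⊗ (P ⊗ P ⊗ Q)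
      ≈⟨ solve 4 (λ z s P Q →
           ((con 1ℤ :- z) :* (con 1ℤ :- z) :+
            con (+ 4) :* ((con 1ℤ :- z) :* (con 1ℤ :- z) :* s)) :* (P :* P :* Q) :=
           (con 1ℤ :- z) :* P :* ((con 1ℤ :- z) :* P) :* ((con 1ℤ :+ con (+ 4) :* s) :* Q))
         ≈-refl z s P Q ⟩
    (1# ⊖ z) ⊗ P ⊗ ((1# ⊖ z) ⊗ P) ⊗ ((1# ⊕ κ (+ 4) ⊗ s) ⊗ Q) ∎
    where
    z = y ^ suc m
    s = squareLambert y n m
    N = ∏ (factors⁺ y) m
    P = ∏ (factors⁻ y) m
    Q = ∏ (λ i → 1# ⊕ κ (+ 4) ⊗ squareLambert y n i) m

  module Derivation (δ : Carrier → Carrier)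
    (δ-cong : ∀ {a b} → a ≈ b → δ a ≈ δ b)
    (δ-* : ∀ a b → δ (a ⊗ b) ≈ δ a ⊗ b ⊕ a ⊗ δ b)
    (δ-1 : δ 1# ≈ 0#) where

    -- The product rule summed over the factors. The 4 reflects y = q⁴ with δ = q d/dq, and it is
    -- the same 4 as in `∏[1+4s]`: this coincidence lets δ of the product absorb the Lambert series.
    logDerivative : ∀ y n → (∀ i → (y ^ suc i) ^ suc n ≈ 0#) →
      (∀ i → δ (factors⁻ y i) ≈ ⊝ (κ (+ 4) ⊗ (κ (+ suc i) ⊗ y ^ suc i))) → ∀ m →
      δ (∏ (factors⁻ y) m) ≈ ⊝ (κ (+ 4) ⊗ (∏ (factors⁻ y) m ⊗ ∑ (lambert y n) m))
    logDerivative y n y≈0 δ-factor zero    = ≈-trans δ-1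
      (solve 0 (con 0ℤ := :- (con (+ 4) :* (con 1ℤ :* con 0ℤ))) ≈-refl)
    logDerivative y n y≈0 δ-factor (suc m) = begin
      δ ((1# ⊖ z) ⊗ P)
        ≈⟨ δ-* _ _ ⟩
      δ (1# ⊖ z) ⊗ P ⊕ (1# ⊖ z) ⊗ δ P
        ≈⟨ +-cong (*-congʳ (≈-trans (δ-factor m)
                     (-‿cong (*-congˡ (≈-sym (geometric (κ (+ suc m)) z n (y≈0 m)))))))
                  (*-congˡ (logDerivative y n y≈0 δ-factor m)) ⟩
      ⊝ (κ (+ 4) ⊗ ((1# ⊖ z) ⊗ l)) ⊗ P ⊕ (1# ⊖ z) ⊗ (⊝ (κ (+ 4) ⊗ (P ⊗ ∑ (lambert y n) m)))
        ≈⟨ solve 4 (λ z l P t →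
             (:- (con (+ 4) :* ((con 1ℤ :- z) :* l))) :* P :+
             (con 1ℤ :- z) :* (:- (con (+ 4) :* (P :* t))) :=
             :- (con (+ 4) :* ((con 1ℤ :- z) :* P :* (l :+ t))))
           ≈-refl z l P (∑ (lambert y n) m) ⟩
      ⊝ (κ (+ 4) ⊗ ((1# ⊖ z) ⊗ P ⊗ (l ⊕ ∑ (lambert y n) m))) ∎
      where
      z = y ^ suc m
      l = lambert y n m
      P = ∏ (factors⁻ y) m

  -- Dissection by the parity of the exponent.

  ^-*2 : ∀ x i → x ^ (i * 2) ≈ (x ⊗ x) ^ i
  ^-*2 x zero    = ≈-refl
  ^-*2 x (suc i) = ≈-trans (*-congˡ (*-congˡ (^-*2 x i)))
    (solve 2 (λ x p → x :* (x :* p) := x :* x :* p) ≈-refl x _)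

  ⊝-^-odd : ∀ x i → (⊝ x) ^ suc (i * 2) ≈ ⊝ (x ^ suc (i * 2))
  ⊝-^-odd x i = begin
    ⊝ x ⊗ (⊝ x) ^ (i * 2)     ≈⟨ *-congˡ (^-*2 (⊝ x) i) ⟩
    ⊝ x ⊗ (⊝ x ⊗ ⊝ x) ^ i     ≈⟨ *-congˡ (^-congˡ i (⊝x²≈x² x)) ⟩
    ⊝ x ⊗ (x ⊗ x) ^ i         ≈⟨ *-congˡ (^-*2 x i) ⟨
    ⊝ x ⊗ x ^ (i * 2)         ≈⟨ solve 2 (λ x p → (:- x) :* p := :- (x :* p)) ≈-refl x _ ⟩
    ⊝ (x ⊗ x ^ (i * 2))       ∎
    where
    ⊝x²≈x² : ∀ x → ⊝ x ⊗ ⊝ x ≈ x ⊗ x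
    ⊝x²≈x² = solve 1 (λ x → (:- x) :* (:- x) := x :* x) ≈-refl

  factors⁻-cong : ∀ {x y} → x ≈ y → ∀ i → factors⁻ x i ≈ factors⁻ y i
  factors⁻-cong x≈y i = +-congˡ (-‿cong (^-congˡ (suc i) x≈y))

  -- Products in x have n * 2 factors, so that odd and even exponents pair off exactly. Of the two
  -- forms of `f₄`, the one with n factors is the even half of such a product, while the one with n
  -- * 2 factors arises from multiplying 1 - x^i by 1 + x^i throughout.
  module Dissection {x y a f₂ f₄ : Carrier} (n : ℕ)
    (y≈x² : y ≈ x ⊗ x)
    (⊝x-nilpotent : (⊝ x) ^ (n * 2) ≈ 0#)
    (y-nilpotent : ∀ i → (y ^ suc i) ^ suc n ≈ 0#)
    (f₂≈∏ : f₂ ≈ ∏ (factors⁻ x) (n * 2))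
    (f₄≈∏ : f₄ ≈ ∏ (factors⁻ y) n)
    (f₄≈∏₂ : f₄ ≈ ∏ (factors⁻ y) (n * 2))
    (f₄-cancel : ∀ {u v} → u ⊗ f₄ ≈ v ⊗ f₄ → u ≈ v)
    (a-defining : a ⊗ (f₂ ⊗ f₂) ≈ f₄ ⊗ f₄)
    where

    odd⁺ odd⁻ N g Q : Carrier
    odd⁺ = ∏ (λ i → 1# ⊕ x ^ suc (i * 2)) n
    odd⁻ = ∏ (λ i → 1# ⊖ x ^ suc (i * 2)) n
    N = ∏ (factors⁺ y) n
    g = gaussTail (⊝ x) (n * 2)
    Q = ∏ (λ i → 1# ⊕ κ (+ 4) ⊗ squareLambert y n i) n

    y^≈ : ∀ i → x ^ suc (suc (i * 2)) ≈ y ^ suc i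
    y^≈ i = ≈-trans (^-*2 x (suc i)) (^-congˡ (suc i) (≈-sym y≈x²))

    ⊝x^≈ : ∀ i → (⊝ x) ^ suc (suc (i * 2)) ≈ y ^ suc i
    ⊝x^≈ i = begin
      ⊝ x ⊗ (⊝ x) ^ suc (i * 2)   ≈⟨ *-congˡ (⊝-^-odd x i) ⟩
      ⊝ x ⊗ ⊝ (x ^ suc (i * 2))   ≈⟨ solve 2 (λ x p → (:- x) :* (:- p) := x :* p) ≈-refl x _ ⟩
      x ⊗ x ^ suc (i * 2)         ≈⟨ y^≈ i ⟩
      y ^ suc i                   ∎

    f₂≈ : f₂ ≈ odd⁻ ⊗ f₄
    f₂≈ = begin
      f₂                          ≈⟨ f₂≈∏ ⟩
      -- Index i carries the exponent i + 1, so the even indices give the odd exponents.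
      ∏ (factors⁻ x) (n * 2)      ≈⟨ ∏-alternate (factors⁻ x) n ⟩
      odd⁻ ⊗ _                    ≈⟨ *-congˡ (∏-cong (λ i → +-congˡ (-‿cong (y^≈ i))) n) ⟩
      odd⁻ ⊗ ∏ (factors⁻ y) n     ≈⟨ *-congˡ f₄≈∏ ⟨
      odd⁻ ⊗ f₄                   ∎

    -- As f₂ = odd⁻ f₄, the quotient f₄² / f₂² is 1 / odd⁻².
    a-odd⁻² : a ⊗ (odd⁻ ⊗ odd⁻) ≈ 1#
    a-odd⁻² = f₄-cancel (f₄-cancel (begin
      a ⊗ (odd⁻ ⊗ odd⁻) ⊗ f₄ ⊗ f₄
        ≈⟨ solve 3 (λ a o f → a :* (o :* o) :* f :* f := a :* (o :* f :* (o :* f)))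
             ≈-refl a odd⁻ f₄ ⟩
      a ⊗ (odd⁻ ⊗ f₄ ⊗ (odd⁻ ⊗ f₄))  ≈⟨ *-congˡ (*-cong f₂≈ f₂≈) ⟨
      a ⊗ (f₂ ⊗ f₂)                  ≈⟨ a-defining ⟩
      f₄ ⊗ f₄                        ≈⟨ *-congʳ (*-identityˡ f₄) ⟨
      1# ⊗ f₄ ⊗ f₄                   ∎))

    -- Euler's identity between distinct and odd parts: odd⁺ N is the product of all 1 + x^i, and
    -- multiplying it by the product odd⁻ f₄ of all 1 - x^i gives f₄ again.
    odd⁻-odd⁺-N : odd⁻ ⊗ odd⁺ ⊗ N ≈ 1#
    odd⁻-odd⁺-N = f₄-cancel (begin
      odd⁻ ⊗ odd⁺ ⊗ N ⊗ f₄
        ≈⟨ solve 4 (λ o p N f → o :* p :* N :* f := o :* f :* (p :* N)) ≈-refl odd⁻ odd⁺ N f₄ ⟩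
      odd⁻ ⊗ f₄ ⊗ (odd⁺ ⊗ N)
        ≈⟨ *-cong (≈-trans (≈-sym f₂≈) f₂≈∏)
             (≈-trans (*-congˡ (∏-cong (λ i → +-congˡ (≈-sym (y^≈ i))) n))
                      (≈-sym (∏-alternate (factors⁺ x) n))) ⟩
      ∏ (factors⁻ x) (n * 2) ⊗ ∏ (factors⁺ x) (n * 2)
        ≈⟨ ∏-* (factors⁻ x) (factors⁺ x) (n * 2) ⟨
      ∏ (λ i → factors⁻ x i ⊗ factors⁺ x i) (n * 2)
        ≈⟨ ∏-cong difference-of-squares (n * 2) ⟩
      ∏ (factors⁻ y) (n * 2)
        ≈⟨ f₄≈∏₂ ⟨
      f₄
        ≈⟨ *-identityˡ f₄ ⟨
      1# ⊗ f₄ ∎)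
      where
      difference-of-squares : ∀ i → factors⁻ x i ⊗ factors⁺ x i ≈ factors⁻ y i
      difference-of-squares i = begin
        (1# ⊖ x ^ suc i) ⊗ (1# ⊕ x ^ suc i)
          ≈⟨ solve 1 (λ p → (con 1ℤ :- p) :* (con 1ℤ :+ p) := con 1ℤ :- p :* p) ≈-refl _ ⟩
        1# ⊖ x ^ suc i ⊗ x ^ suc i
          ≈⟨ +-congˡ (-‿cong (^-distrib-* x x (suc i))) ⟨
        factors⁻ (x ⊗ x) i
          ≈⟨ factors⁻-cong y≈x² i ⟨
        factors⁻ y i ∎

    -- Gauss's identity at -x. The sign affects odd exponents only, so it exchanges `odd⁺` and
    -- `odd⁻`; in g the signs (-1)^m and (-1)^(m²) cancel.
    gauss-odd : odd⁻ ⊗ N ⊗ (1# ⊕ κ (+ 2) ⊗ g) ≈ odd⁺ ⊗ f₄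
    gauss-odd = begin
      odd⁻ ⊗ N ⊗ (1# ⊕ κ (+ 2) ⊗ g)
        ≈⟨ *-congʳ (≈-trans (∏-alternate (factors⁺ (⊝ x)) n) (*-cong
             (∏-cong (λ i → +-congˡ (⊝-^-odd x i)) n) (∏-cong (λ i → +-congˡ (⊝x^≈ i)) n))) ⟨
      ∏ (factors⁺ (⊝ x)) (n * 2) ⊗ (1# ⊕ κ (+ 2) ⊗ g)
        ≈⟨ gauss (⊝ x) (n * 2) ⊝x-nilpotent ⟩
      ∏ (factors⁻ (⊝ x)) (n * 2)
        ≈⟨ ∏-alternate (factors⁻ (⊝ x)) n ⟩
      _ ≈⟨ *-cong
             (∏-cong (λ i → +-congˡ (≈-trans (-‿cong (⊝-^-odd x i))
                (solve 1 (λ p → :- (:- p) := p) ≈-refl _))) n)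
             (≈-trans (∏-cong (λ i → +-congˡ (-‿cong (⊝x^≈ i))) n) (≈-sym f₄≈∏)) ⟩
      odd⁺ ⊗ f₄ ∎

    -- Inserting odd⁻ odd⁺ N = 1 and replacing odd⁺ f₄ by `gauss-odd` produces odd⁻², which a
    -- cancels. What remains is N² φ = f₄² Q φ.
    a≈ : a ≈ (1# ⊕ κ (+ 2) ⊗ g) ⊗ (f₄ ⊗ Q)
    a≈ = f₄-cancel (begin
      a ⊗ f₄
        ≈⟨ *-congˡ (*-identityˡ f₄) ⟨
      a ⊗ (1# ⊗ f₄)
        ≈⟨ *-congˡ (*-congʳ odd⁻-odd⁺-N) ⟨
      a ⊗ (odd⁻ ⊗ odd⁺ ⊗ N ⊗ f₄)
        ≈⟨ solve 5 (λ a o p N f → a :* (o :* p :* N :* f) := a :* o :* N :* (p :* f))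
             ≈-refl a odd⁻ odd⁺ N f₄ ⟩
      a ⊗ odd⁻ ⊗ N ⊗ (odd⁺ ⊗ f₄)
        ≈⟨ *-congˡ gauss-odd ⟨
      a ⊗ odd⁻ ⊗ N ⊗ (odd⁻ ⊗ N ⊗ φ)
        ≈⟨ solve 4 (λ a o N φ → a :* o :* N :* (o :* N :* φ) := a :* (o :* o) :* (N :* N) :* φ)
             ≈-refl a odd⁻ N φ ⟩
      a ⊗ (odd⁻ ⊗ odd⁻) ⊗ (N ⊗ N) ⊗ φ
        ≈⟨ *-congʳ (*-cong a-odd⁻² (∏-factors-square y n y-nilpotent n)) ⟩
      1# ⊗ (∏ (factors⁻ y) n ⊗ ∏ (factors⁻ y) n ⊗ Q) ⊗ φ
        ≈⟨ *-congʳ (*-congˡ (*-congʳ (*-cong f₄≈∏ f₄≈∏))) ⟨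
      1# ⊗ (f₄ ⊗ f₄ ⊗ Q) ⊗ φ
        ≈⟨ solve 3 (λ f Q φ → con 1ℤ :* (f :* f :* Q) :* φ := φ :* (f :* Q) :* f)
             ≈-refl f₄ Q φ ⟩
      φ ⊗ (f₄ ⊗ Q) ⊗ f₄ ∎)
      where φ = 1# ⊕ κ (+ 2) ⊗ g

    module _ (δ : Carrier → Carrier)
      (δ-cong : ∀ {a b} → a ≈ b → δ a ≈ δ b)
      (δ-* : ∀ a b → δ (a ⊗ b) ≈ δ a ⊗ b ⊕ a ⊗ δ b)
      (δ-1 : δ 1# ≈ 0#)
      (δ-factor : ∀ i → δ (factors⁻ y i) ≈ ⊝ (κ (+ 4) ⊗ (κ (+ suc i) ⊗ y ^ suc i)))
      where

      -- In 2 g f₄ Q the factor 2 makes Q modulo 16 suffice. In f₄ Q the factor Q is kept exact,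
      -- since there only the exponents will matter.
      a-mod-32 : ∃[ u ] a ≈
        f₄ ⊗ Q ⊕ κ (+ 2) ⊗ (g ⊗ f₄) ⊕ κ (ℤ.- + 2) ⊗ (g ⊗ δ f₄) ⊕ κ (+ 32) ⊗ u
      a-mod-32 with ∏[1+4s] (squareLambert y n) n
      ... | u , Q≈ = g ⊗ f₄ ⊗ u , (begin
        a
          ≈⟨ a≈ ⟩
        (1# ⊕ κ (+ 2) ⊗ g) ⊗ (f₄ ⊗ Q)
          ≈⟨ solve 3 (λ g f Q → (con 1ℤ :+ con (+ 2) :* g) :* (f :* Q) :=
               f :* Q :+ con (+ 2) :* (g :* f) :* Q) ≈-refl g f₄ Q ⟩
        f₄ ⊗ Q ⊕ κ (+ 2) ⊗ (g ⊗ f₄) ⊗ Q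
          ≈⟨ +-congˡ (*-congˡ (≈-trans Q≈ (+-congʳ (+-congˡ (*-congˡ (∑-squareLambert y n)))))) ⟩
        f₄ ⊗ Q ⊕ κ (+ 2) ⊗ (g ⊗ f₄) ⊗ (1# ⊕ κ (+ 4) ⊗ t ⊕ κ (+ 16) ⊗ u)
          ≈⟨ solve 5 (λ g f Q t u →
               f :* Q :+ con (+ 2) :* (g :* f) :* (con 1ℤ :+ con (+ 4) :* t :+ con (+ 16) :* u) :=
               f :* Q :+ con (+ 2) :* (g :* f) :+
               con (ℤ.- + 2) :* (g :* (:- (con (+ 4) :* (f :* t)))) :+ con (+ 32) :* (g :* f :* u))
             ≈-refl g f₄ Q t u ⟩
        f₄ ⊗ Q ⊕ κ (+ 2) ⊗ (g ⊗ f₄) ⊕ κ (ℤ.- + 2) ⊗ (g ⊗ ⊝ (κ (+ 4) ⊗ (f₄ ⊗ t))) ⊕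
          κ (+ 32) ⊗ (g ⊗ f₄ ⊗ u)
          ≈⟨ +-congʳ (+-congˡ (*-congˡ (*-congˡ (begin
               δ f₄                               ≈⟨ δ-cong f₄≈∏ ⟩
               δ (∏ (factors⁻ y) n)               ≈⟨ logDerivative y n y-nilpotent δ-factor n ⟩
               ⊝ (κ (+ 4) ⊗ (∏ (factors⁻ y) n ⊗ t))
                                                  ≈⟨ -‿cong (*-congˡ (*-congʳ f₄≈∏)) ⟨
               ⊝ (κ (+ 4) ⊗ (f₄ ⊗ t))             ∎)))) ⟨
        f₄ ⊗ Q ⊕ κ (+ 2) ⊗ (g ⊗ f₄) ⊕ κ (ℤ.- + 2) ⊗ (g ⊗ δ f₄) ⊕ κ (+ 32) ⊗ (g ⊗ f₄ ⊗ u) ∎)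
        where
        open Derivation δ δ-cong δ-* δ-1
        t = ∑ (lambert y n) n

-- Power series under convolution.

infixl 6 _⊞_ _⊟_
infix  8 ⊝_

_⊞_ : Series → Series → Series
(a ⊞ b) n = a n ℤ.+ b n

⊝_ : Series → Series
(⊝ a) n = ℤ.- a n

_⊟_ : Series → Series → Series
a ⊟ b = a ⊞ ⊝ b

const : ℤ → Series
const c zero    = c
const c (suc n) = 0ℤ

tail : Series → Series
tail a n = a (suc n)

θ : Series → Series
θ a n = + n ℤ.* a n

-- A coefficient of a product sees no higher coefficients of the factors; hence truncation below a
-- degree is compatible with multiplication.
⊛-cong-≤ : ∀ {a a′ b b′} n → (∀ i → i ≤ n → a i ≡ a′ i) → (∀ i → i ≤ n → b i ≡ b′ i) →
           (a ⊛ b) n ≡ (a′ ⊛ b′) n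
⊛-cong-≤ zero    p q = cong₂ (λ u v → u ℤ.* v ℤ.+ 0ℤ) (p 0 z≤n) (q 0 z≤n)
⊛-cong-≤ (suc n) p q = cong₂ ℤ._+_
  (cong₂ ℤ._*_ (p 0 z≤n) (q (suc n) ℕ.≤-refl))
  (⊛-cong-≤ n (λ i i≤n → p (suc i) (s≤s i≤n)) (λ i i≤n → q i (ℕ.m≤n⇒m≤1+n i≤n)))

⊛-distribʳ : ∀ c a b → (a ⊞ b) ⊛ c ≗ (a ⊛ c) ⊞ (b ⊛ c)
⊛-distribʳ c a b zero = solve 3 (λ a b c → (a :+ b) :* c :+ con 0ℤ :=
    a :* c :+ con 0ℤ :+ (b :* c :+ con 0ℤ)) refl (a 0) (b 0) (c 0)
  where open ℤ-Solver
⊛-distribʳ c a b (suc n) rewrite ⊛-distribʳ c (tail a) (tail b) n =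
  solve 5 (λ a b c s t → (a :+ b) :* c :+ (s :+ t) := a :* c :+ s :+ (b :* c :+ t))
    refl (a 0) (b 0) (c (suc n)) ((tail a ⊛ c) n) ((tail b ⊛ c) n)
  where open ℤ-Solver

⊛-scale : ∀ k a b → (λ n → k ℤ.* a n) ⊛ b ≗ (λ n → k ℤ.* (a ⊛ b) n)
⊛-scale k a b zero = solve 3 (λ k a b → k :* a :* b :+ con 0ℤ := k :* (a :* b :+ con 0ℤ))
    refl k (a 0) (b 0)
  where open ℤ-Solver
⊛-scale k a b (suc n) rewrite ⊛-scale k (tail a) b n =
  solve 4 (λ k a b s → k :* a :* b :+ k :* s := k :* (a :* b :+ s))
    refl k (a 0) (b (suc n)) ((tail a ⊛ b) n)
  where open ℤ-Solver

-- Convolution unfolds by peeling the left factor. Peeling the right one as well is what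
-- commutativity needs.
⊛-suc : ∀ a b n → (a ⊛ b) (suc n) ≡ a (suc n) ℤ.* b 0 ℤ.+ (a ⊛ tail b) n
⊛-suc a b zero = solve 4 (λ a₀ a₁ b₀ b₁ →
    a₀ :* b₁ :+ (a₁ :* b₀ :+ con 0ℤ) := a₁ :* b₀ :+ (a₀ :* b₁ :+ con 0ℤ))
    refl (a 0) (a 1) (b 0) (b 1)
  where open ℤ-Solver
⊛-suc a b (suc n) rewrite ⊛-suc (tail a) b n =
  solve 3 (λ u v w → u :+ (v :+ w) := v :+ (u :+ w))
    refl (a 0 ℤ.* b (suc (suc n))) (a (suc (suc n)) ℤ.* b 0) ((tail a ⊛ tail b) n)
  where open ℤ-Solver

⊛-comm : ∀ a b → a ⊛ b ≗ b ⊛ a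
⊛-comm a b zero    = cong (ℤ._+ 0ℤ) (ℤ.*-comm (a 0) (b 0))
⊛-comm a b (suc n) = trans
  (cong₂ ℤ._+_ (ℤ.*-comm (a 0) (b (suc n))) (⊛-comm (tail a) b n))
  (sym (⊛-suc b a n))

⊛-assoc : ∀ a b c → (a ⊛ b) ⊛ c ≗ a ⊛ (b ⊛ c)
⊛-assoc a b c zero = solve 3 (λ a b c → (a :* b :+ con 0ℤ) :* c :+ con 0ℤ :=
    a :* (b :* c :+ con 0ℤ) :+ con 0ℤ) refl (a 0) (b 0) (c 0)
  where open ℤ-Solver
⊛-assoc a b c (suc n)
  rewrite ⊛-distribʳ c (λ i → a 0 ℤ.* tail b i) (tail a ⊛ b) n
        | ⊛-scale (a 0) (tail b) c n
        | ⊛-assoc (tail a) b c n =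
  solve 5 (λ a b c s t → (a :* b :+ con 0ℤ) :* c :+ (a :* s :+ t) := a :* (b :* c :+ s) :+ t)
    refl (a 0) (b 0) (c (suc n)) ((tail b ⊛ c) n) ((tail a ⊛ (b ⊛ c)) n)
  where open ℤ-Solver

⊛-zeroˡ : ∀ a b → (∀ i → a i ≡ 0ℤ) → ∀ n → (a ⊛ b) n ≡ 0ℤ
⊛-zeroˡ a b a≡0 zero    rewrite a≡0 0 = refl
⊛-zeroˡ a b a≡0 (suc n) rewrite a≡0 0 | ⊛-zeroˡ (tail a) b (λ i → a≡0 (suc i)) n = refl

const-⊛ : ∀ c a n → (const c ⊛ a) n ≡ c ℤ.* a n
const-⊛ c a zero    = ℤ.+-identityʳ _
const-⊛ c a (suc n) =
  trans (cong (λ z → c ℤ.* a (suc n) ℤ.+ z) (⊛-zeroˡ (tail (const c)) a (λ _ → refl) n)) (ℤ.+-identityʳ _)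

-- Induction on the degree: tail (θ a) = tail a + θ (tail a), and the extra tail a is supplied by
-- the 1 in suc n = 1 + n.
θ-⊛ : ∀ a b → θ (a ⊛ b) ≗ (θ a ⊛ b) ⊞ (a ⊛ θ b)
θ-⊛ a b zero = solve 2 (λ a b → con 0ℤ :* (a :* b :+ con 0ℤ) :=
    (con 0ℤ :* a) :* b :+ con 0ℤ :+ (a :* (con 0ℤ :* b) :+ con 0ℤ)) refl (a 0) (b 0)
  where open ℤ-Solver
θ-⊛ a b (suc n) = begin
  + suc n ℤ.* (a₀ ℤ.* bₙ ℤ.+ s)
    ≡⟨ solve 4 (λ m a b s → (con 1ℤ :+ m) :* (a :* b :+ s) :=
         a :* ((con 1ℤ :+ m) :* b) :+ (s :+ m :* s)) refl (+ n) a₀ bₙ s ⟩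
  a₀ ℤ.* (+ suc n ℤ.* bₙ) ℤ.+ (s ℤ.+ + n ℤ.* s)
    ≡⟨ cong (λ t → a₀ ℤ.* (+ suc n ℤ.* bₙ) ℤ.+ (s ℤ.+ t)) (θ-⊛ (tail a) b n) ⟩
  a₀ ℤ.* (+ suc n ℤ.* bₙ) ℤ.+ (s ℤ.+ ((θ (tail a) ⊛ b) n ℤ.+ (tail a ⊛ θ b) n))
    ≡⟨ solve 5 (λ a c s t u → a :* c :+ (s :+ (t :+ u)) := (s :+ t) :+ (a :* c :+ u))
         refl a₀ (+ suc n ℤ.* bₙ) s ((θ (tail a) ⊛ b) n) ((tail a ⊛ θ b) n) ⟩
  s ℤ.+ (θ (tail a) ⊛ b) n ℤ.+ (a ⊛ θ b) (suc n)
    ≡⟨ cong (ℤ._+ (a ⊛ θ b) (suc n)) (⊛-distribʳ b (tail a) (θ (tail a)) n) ⟨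
  ((tail a ⊞ θ (tail a)) ⊛ b) n ℤ.+ (a ⊛ θ b) (suc n)
    ≡⟨ cong (ℤ._+ (a ⊛ θ b) (suc n)) (⊛-cong-≤ {tail a ⊞ θ (tail a)} {tail (θ a)} {b} {b} n
         (λ i _ → sym (tail-θ i)) (λ _ _ → refl)) ⟩
  (tail (θ a) ⊛ b) n ℤ.+ (a ⊛ θ b) (suc n)
    ≡⟨ cong (ℤ._+ (a ⊛ θ b) (suc n)) (solve 2 (λ b s → con 0ℤ :* b :+ s := s) refl bₙ
         ((tail (θ a) ⊛ b) n)) ⟨
  0ℤ ℤ.* bₙ ℤ.+ (tail (θ a) ⊛ b) n ℤ.+ (a ⊛ θ b) (suc n)
    ≡⟨ cong (λ z → z ℤ.* bₙ ℤ.+ (tail (θ a) ⊛ b) n ℤ.+ (a ⊛ θ b) (suc n)) (ℤ.*-zeroˡ a₀) ⟨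
  (θ a ⊛ b) (suc n) ℤ.+ (a ⊛ θ b) (suc n) ∎
  where
  open ℤ-Solver
  open ≡-Reasoning
  a₀ = a 0
  bₙ = b (suc n)
  s = (tail a ⊛ b) n
  tail-θ : ∀ i → tail (θ a) i ≡ a (suc i) ℤ.+ + i ℤ.* a (suc i)
  tail-θ i = solve 2 (λ m a → (con 1ℤ :+ m) :* a := a :+ m :* a) refl (+ i) (a (suc i))

-- `A` stands for membership of n in a support. The disjunction suits existential predicates, for
-- which no decision procedure is at hand: either some pair (i, j) yields `A`, or all terms vanish.
⊛-alternative : ∀ {A : Set} a b n → (∀ i j → i + j ≡ n → A ⊎ a i ℤ.* b j ≡ 0ℤ) →
                A ⊎ (a ⊛ b) n ≡ 0ℤ
⊛-alternative a b zero    h = map₂ (cong (ℤ._+ 0ℤ)) (h 0 0 refl)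
⊛-alternative a b (suc n) h
  with h 0 (suc n) refl | ⊛-alternative (tail a) b n (λ i j i+j≡n → h (suc i) j (cong suc i+j≡n))
... | inj₁ p | _      = inj₁ p
... | inj₂ _ | inj₁ p = inj₁ p
... | inj₂ u | inj₂ v = inj₂ (cong₂ ℤ._+_ u v)

q^-alternative : ∀ k n → n ≡ k ⊎ (q^ k) n ≡ 0ℤ
q^-alternative zero    zero    = inj₁ refl
q^-alternative zero    (suc n) = inj₂ refl
q^-alternative (suc k) zero    = inj₂ refl
q^-alternative (suc k) (suc n) = map₁ (cong suc) (q^-alternative k n)

q^0≗1 : q^ 0 ≗ const 1ℤ
q^0≗1 zero    = refl
q^0≗1 (suc n) = refl

q^-suc : ∀ m → q^ suc m ≗ (q^ 1) ⊛ (q^ m)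
q^-suc m zero    = refl
q^-suc m (suc n) = sym (trans (ℤ.+-identityˡ ((tail (q^ 1) ⊛ (q^ m)) n))
  (trans (⊛-cong-≤ {tail (q^ 1)} {const 1ℤ} {q^ m} {q^ m} n (λ i _ → q^0≗1 i) (λ _ _ → refl))
         (trans (const-⊛ 1ℤ (q^ m) n) (ℤ.*-identityˡ ((q^ m) n)))))

θ-1-q^ : ∀ m → θ (1-q^ m) ≗ ⊝ (const (+ m) ⊛ (q^ m))
θ-1-q^ m n = begin
  + n ℤ.* (1-q^ m) n                        ≡⟨ expand (+ n) ((q^ 0) n) ((q^ m) n) ⟩
  + n ℤ.* (q^ 0) n ℤ.- + n ℤ.* (q^ m) n     ≡⟨ cong₂ ℤ._-_ (n*[q⁰]ₙ≡0 n) (n≡m-or-0 (q^-alternative m n)) ⟩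
  0ℤ ℤ.- + m ℤ.* (q^ m) n                   ≡⟨ ℤ.+-identityˡ _ ⟩
  ℤ.- (+ m ℤ.* (q^ m) n)                    ≡⟨ cong (λ c → ℤ.- c) (const-⊛ (+ m) (q^ m) n) ⟨
  ℤ.- (const (+ m) ⊛ (q^ m)) n              ∎
  where
  open ≡-Reasoning
  expand : ∀ a b c → a ℤ.* (b ℤ.- c) ≡ a ℤ.* b ℤ.- a ℤ.* c
  expand = solve 3 (λ a b c → a :* (b :- c) := a :* b :- a :* c) refl
    where open ℤ-Solver
  n*[q⁰]ₙ≡0 : ∀ n → + n ℤ.* (q^ 0) n ≡ 0ℤ
  n*[q⁰]ₙ≡0 zero    = refl
  n*[q⁰]ₙ≡0 (suc n) = ℤ.*-zeroʳ (+ suc n)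
  n≡m-or-0 : n ≡ m ⊎ (q^ m) n ≡ 0ℤ → + n ℤ.* (q^ m) n ≡ + m ℤ.* (q^ m) n
  n≡m-or-0 (inj₁ n≡m) = cong (λ k → + k ℤ.* (q^ m) n) n≡m
  n≡m-or-0 (inj₂ eq)  = trans (cong (+ n ℤ.*_) eq)
    (trans (ℤ.*-zeroʳ (+ n)) (sym (trans (cong (+ m ℤ.*_) eq) (ℤ.*-zeroʳ (+ m)))))

-- Series modulo q^K.

module Truncated (K : ℕ) where

  infix 4 _≈_

  -- As a record, the relation lets unification recover `a` and `b`.
  record _≈_ (a b : Series) : Set where
    constructor below
    field at : ∀ n → n < K → a n ≡ b n
  open _≈_ public

  ≗⇒≈ : ∀ {a b} → a ≗ b → a ≈ b
  ≗⇒≈ a≗b = below λ n _ → a≗b n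

  ⊛-cong : ∀ {a a′ b b′} → a ≈ a′ → b ≈ b′ → a ⊛ b ≈ a′ ⊛ b′
  ⊛-cong a≈a′ b≈b′ = below λ n n<K → ⊛-cong-≤ n
    (λ i i≤n → at a≈a′ i (ℕ.≤-<-trans i≤n n<K)) (λ i i≤n → at b≈b′ i (ℕ.≤-<-trans i≤n n<K))

  θ-cong : ∀ {a b} → a ≈ b → θ a ≈ θ b
  θ-cong a≈b = below λ n n<K → cong (+ n ℤ.*_) (at a≈b n n<K)

  isCommutativeRing : IsCommutativeRing _≈_ _⊞_ _⊛_ ⊝_ (const 0ℤ) (const 1ℤ)
  isCommutativeRing = record
    { isRing = record
      { +-isAbelianGroup = record
        { isGroup = record
          { isMonoid = record
            { isSemigroup = record
              { isMagma = record
                { isEquivalence = record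
                  { refl  = below λ _ _ → refl
                  ; sym   = λ p → below λ n l → sym (at p n l)
                  ; trans = λ p q → below λ n l → trans (at p n l) (at q n l)
                  }
                ; ∙-cong = λ p q → below λ n l → cong₂ ℤ._+_ (at p n l) (at q n l)
                }
              ; assoc = λ a b c → ≗⇒≈ λ n → ℤ.+-assoc (a n) (b n) (c n)
              }
            ; identity = (λ a → ≗⇒≈ (+-identityˡ a))
                       , (λ a → ≗⇒≈ λ n → trans (ℤ.+-comm (a n) _) (+-identityˡ a n))
            }
          ; inverse = (λ a → ≗⇒≈ (+-inverseˡ a))
                    , (λ a → ≗⇒≈ λ n → trans (ℤ.+-comm (a n) _) (+-inverseˡ a n))
          ; ⁻¹-cong = λ p → below λ n l → cong (λ c → ℤ.- c) (at p n l)
          }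
        ; comm = λ a b → ≗⇒≈ λ n → ℤ.+-comm (a n) (b n)
        }
      ; *-cong = ⊛-cong
      ; *-assoc = λ a b c → ≗⇒≈ (⊛-assoc a b c)
      ; *-identity = (λ a → ≗⇒≈ (*-identityˡ a))
                   , (λ a → ≗⇒≈ λ n → trans (⊛-comm a (const 1ℤ) n) (*-identityˡ a n))
      ; distrib = (λ a b c → ≗⇒≈ λ n → trans (⊛-comm a (b ⊞ c) n)
                    (trans (⊛-distribʳ a b c n) (cong₂ ℤ._+_ (⊛-comm b a n) (⊛-comm c a n))))
                , (λ a b c → ≗⇒≈ (⊛-distribʳ a b c))
      }
    ; *-comm = λ a b → ≗⇒≈ (⊛-comm a b)
    }
    where
    +-identityˡ : ∀ a → const 0ℤ ⊞ a ≗ a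
    +-identityˡ a zero    = ℤ.+-identityˡ _
    +-identityˡ a (suc n) = ℤ.+-identityˡ _
    +-inverseˡ : ∀ a → (⊝ a) ⊞ a ≗ const 0ℤ
    +-inverseˡ a zero    = ℤ.+-inverseˡ (a 0)
    +-inverseˡ a (suc n) = ℤ.+-inverseˡ (a (suc n))
    *-identityˡ : ∀ a → const 1ℤ ⊛ a ≗ a
    *-identityˡ a n = trans (const-⊛ 1ℤ a n) (ℤ.*-identityˡ (a n))

  ring : CommutativeRing 0ℓ 0ℓ
  ring = record { isCommutativeRing = isCommutativeRing }

  open CommutativeRing ring public
    using (setoid; +-cong; *-congˡ; *-congʳ; -‿cong; *-assoc; *-comm; *-identityʳ)
    renaming (refl to ≈-refl; sym to ≈-sym; trans to ≈-trans)
  open import Relation.Binary.Reasoning.Setoid setoid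

  const-hom : CommutativeRing.rawRing ℤ.+-*-commutativeRing
              -Raw-AlmostCommutative⟶ fromCommutativeRing ring
  const-hom = record
    { ⟦_⟧    = const
    ; +-homo = λ c d → ≗⇒≈ λ { zero → refl ; (suc n) → refl }
    ; *-homo = λ c d → ≗⇒≈ λ { zero    → sym (const-⊛ c (const d) 0)
                             ; (suc n) → sym (trans (const-⊛ c (const d) (suc n)) (ℤ.*-zeroʳ c)) }
    ; -‿homo = λ c → ≗⇒≈ λ { zero → refl ; (suc n) → refl }
    ; 0-homo = ≈-refl
    ; 1-homo = ≈-refl
    }

  open RingIdentities ring const-hom public

  -- Constant term 1 makes c a unit, with inverse given by long division.
  ⊛-cancelʳ : ∀ {a b} c → c 0 ≡ 1ℤ → a ⊛ c ≈ b ⊛ c → a ≈ b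
  ⊛-cancelʳ {a} {b} c c₀≡1 ac≈bc = begin
    a               ≈⟨ expand a ⟩
    a ⊛ c ⊛ c⁻¹     ≈⟨ *-congʳ {c⁻¹} ac≈bc ⟩
    b ⊛ c ⊛ c⁻¹     ≈⟨ expand b ⟨
    b               ∎
    where
    c⁻¹ : Series
    c⁻¹ = const 1ℤ ⊘ c
    expand : ∀ d → d ≈ d ⊛ c ⊛ c⁻¹
    expand d = begin
      d               ≈⟨ *-identityʳ d ⟨
      d ⊛ const 1ℤ    ≈⟨ *-congˡ {d} (≗⇒≈ (⊘-⊛ (const 1ℤ) c c₀≡1)) ⟨
      d ⊛ (c⁻¹ ⊛ c)   ≈⟨ ≈-trans (*-congˡ {d} (*-comm c⁻¹ c)) (≈-sym (*-assoc d c c⁻¹)) ⟩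
      d ⊛ c ⊛ c⁻¹     ∎

  -- Supports of series.

  record Supported (P : ℕ → Set) (a : Series) : Set where
    constructor support
    field off : ∀ n → n < K → P n ⊎ a n ≡ 0ℤ
  open Supported public

  Supported-≈ : ∀ {P a b} → a ≈ b → Supported P b → Supported P a
  Supported-≈ a≈b s = support λ n n<K → map₂ (trans (at a≈b n n<K)) (off s n n<K)

  Supported-map : ∀ {P Q : ℕ → Set} {a} → (∀ {n} → P n → Q n) → Supported P a → Supported Q a
  Supported-map P⇒Q s = support λ n n<K → map₁ P⇒Q (off s n n<K)

  Supported-const : ∀ {P} c → P 0 → Supported P (const c)
  Supported-const c P₀ = support λ { zero _ → inj₁ P₀ ; (suc n) _ → inj₂ refl }

  Supported-0 : ∀ {P} → Supported P (const 0ℤ)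
  Supported-0 = support λ { zero _ → inj₂ refl ; (suc n) _ → inj₂ refl }

  Supported-⊞ : ∀ {P a b} → Supported P a → Supported P b → Supported P (a ⊞ b)
  Supported-⊞ s t = support λ n n<K → add (off s n n<K) (off t n n<K)
    where
    add : ∀ {A : Set} {c d} → A ⊎ c ≡ 0ℤ → A ⊎ d ≡ 0ℤ → A ⊎ c ℤ.+ d ≡ 0ℤ
    add (inj₁ p)    _           = inj₁ p
    add (inj₂ _)    (inj₁ p)    = inj₁ p
    add (inj₂ refl) (inj₂ refl) = inj₂ refl

  Supported-⊝ : ∀ {P a} → Supported P a → Supported P (⊝ a)
  Supported-⊝ s = support λ n n<K → map₂ (cong (λ c → ℤ.- c)) (off s n n<K)

  Supported-θ : ∀ {P a} → Supported P a → Supported P (θ a)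
  Supported-θ s = support λ n n<K → map₂
    (λ aₙ≡0 → trans (cong (+ n ℤ.*_) aₙ≡0) (ℤ.*-zeroʳ (+ n))) (off s n n<K)

  Supported-⊛ : ∀ {P Q R : ℕ → Set} {a b} → (∀ {i j} → P i → Q j → R (i + j)) →
                Supported P a → Supported Q b → Supported R (a ⊛ b)
  Supported-⊛ {P} {Q} {R} {a} {b} PQ⇒R s t = support λ n n<K → ⊛-alternative a b n (λ i j i+j≡n →
      subst (λ m → R m ⊎ a i ℤ.* b j ≡ 0ℤ) i+j≡n (mul
        (off s i (ℕ.≤-<-trans (ℕ.m+n≤o⇒m≤o i (ℕ.≤-reflexive i+j≡n)) n<K))
        (off t j (ℕ.≤-<-trans (ℕ.m+n≤o⇒n≤o i (ℕ.≤-reflexive i+j≡n)) n<K))))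
    where
    mul : ∀ {i j} → P i ⊎ a i ≡ 0ℤ → Q j ⊎ b j ≡ 0ℤ → R (i + j) ⊎ a i ℤ.* b j ≡ 0ℤ
    mul (inj₁ p)    (inj₁ q)    = inj₁ (PQ⇒R p q)
    mul {j = j} (inj₂ aᵢ≡0) _   = inj₂ (trans (cong (ℤ._* b j) aᵢ≡0) (ℤ.*-zeroˡ (b j)))
    mul {i} (inj₁ _) (inj₂ bⱼ≡0) = inj₂ (trans (cong (a i ℤ.*_) bⱼ≡0) (ℤ.*-zeroʳ (a i)))

  Supported-^ : ∀ {k a} → Supported (_≡ k) a → ∀ n → Supported (_≡ n * k) (a ^ n)
  Supported-^ s zero    = Supported-const 1ℤ refl
  Supported-^ s (suc n) = Supported-⊛ (cong₂ _+_) s (Supported-^ s n)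

  -- a has order at least 1, so a^n has order at least n ≥ K.
  ^-vanishes : ∀ {a n} → a 0 ≡ 0ℤ → K ≤ n → a ^ n ≈ const 0ℤ
  ^-vanishes {a} {n} a₀≡0 K≤n = below λ m m<K → zeroed m (off (order n) m m<K) (ℕ.<-≤-trans m<K K≤n)
    where
    a-order : Supported (1 ≤_) a
    a-order = support λ { zero _ → inj₂ a₀≡0 ; (suc m) _ → inj₁ (s≤s z≤n) }
    order : ∀ n → Supported (n ≤_) (a ^ n)
    order zero    = Supported-const 1ℤ z≤n
    order (suc n) = Supported-⊛ ℕ.+-mono-≤ a-order (order n)
    zeroed : ∀ m → n ≤ m ⊎ (a ^ n) m ≡ 0ℤ → m < n → (a ^ n) m ≡ const 0ℤ m
    zeroed m       (inj₁ n≤m) m<n = contradiction n≤m (ℕ.<⇒≱ m<n)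
    zeroed zero    (inj₂ eq)  _   = eq
    zeroed (suc m) (inj₂ eq)  _   = eq

  q^-support : ∀ k → Supported (_≡ k) (q^ k)
  q^-support k = support λ n _ → q^-alternative k n

  q^-* : ∀ k i → q^ (k * i) ≈ (q^ k) ^ i
  q^-* k i = begin
    q^ (k * i)            ≈⟨ q^≈ (k * i) ⟩
    (q^ 1) ^ (k * i)      ≈⟨ ^-assocʳ (q^ 1) k i ⟨
    ((q^ 1) ^ k) ^ i      ≈⟨ ^-congˡ i (q^≈ k) ⟨
    (q^ k) ^ i            ∎
    where
    q^≈ : ∀ m → q^ m ≈ (q^ 1) ^ m
    q^≈ zero    = ≗⇒≈ q^0≗1
    q^≈ (suc m) = ≈-trans (≗⇒≈ (q^-suc m)) (*-congˡ {q^ 1} (q^≈ m))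

  1-q^≈ : ∀ k i → 1-q^ (k * suc i) ≈ factors⁻ (q^ k) i
  1-q^≈ k i = +-cong (≗⇒≈ q^0≗1) (-‿cong (q^-* k (suc i)))

  -- From K factors on, the coefficients below K no longer change.
  f≈∏ : ∀ k .{{_ : ℕ.NonZero k}} n → K ≤ n → f k ≈ ∏ (factors⁻ (q^ k)) n
  f≈∏ k n K≤n = ≈-trans
    (below λ i i<K → sym (f-limit k (ℕ.≤-trans (ℕ.<⇒≤ i<K) K≤n))) (partialProduct≈ n)
    where
    partialProduct≈ : ∀ n → partialProduct k n ≈ ∏ (factors⁻ (q^ k)) n
    partialProduct≈ zero    = ≗⇒≈ q^0≗1
    partialProduct≈ (suc n) = ⊛-cong (1-q^≈ k n) (partialProduct≈ n)

  Pentagonal TwiceSquare : ℕ → Set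
  -- Exponents 4 p with p pentagonal, recognised by 24 p + 1 being a square.
  Pentagonal m  = ∃[ t ] 6 * m + 1 ≡ t * t
  TwiceSquare m = ∃[ s ] m ≡ 2 * (s * s)

  -- Shanks's identity with α = 0 and x = q⁴, where `w s` is plus or minus a power of q with
  -- exponent 4 s (s + 1) / 2.
  f₄-support : Supported Pentagonal (f 4)
  f₄-support = Supported-≈
    (≈-trans (f≈∏ 4 K ℕ.≤-refl) (≈-sym (E≈∏ K (^-vanishes refl ℕ.≤-refl)))) (E-support K)
    where
    open Shanks (const 0ℤ) (q^ 4)
    w-support : ∀ s → Supported (_≡ 2 * (s * suc s)) (w s)
    w-support zero    = Supported-const 1ℤ refl
    w-support (suc s) = Supported-⊝ (Supported-⊛ (λ { refl refl → arith s })
      (Supported-⊛ {R = _≡ 2 * (s * suc s) + s * 4} (cong₂ _+_) (w-support s)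
        (Supported-⊞ (Supported-^ (q^-support 4) s) Supported-0))
      (q^-support 4))
      where
      arith : ∀ s → 2 * (s * suc s) + s * 4 + 4 ≡ 2 * (suc s * suc (suc s))
      arith = solve 1 (λ s → con 2 :* (s :* (con 1 :+ s)) :+ s :* con 4 :+ con 4 :=
                con 2 :* ((con 1 :+ s) :* (con 2 :+ s))) refl
        where open ℕ-Solver
    E-support : ∀ n → Supported Pentagonal (E n)
    E-support zero    = Supported-≈ E-zero (Supported-const 1ℤ (1 , refl))
    E-support (suc n) = Supported-≈ (E-suc n) (Supported-⊞
      (Supported-⊛ (λ { refl p → p })
        (Supported-⊞ (Supported-const {P = _≡ 0} 1ℤ refl)
          -- α = 0 has empty support, so 1 + α x^(n+1) lives in exponent 0 alone.
          (Supported-⊛ {P = λ _ → ⊥} (λ ()) Supported-0 (Supported-^ (q^-support 4) (suc n))))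
        (E-support n))
      (Supported-⊛ pentagonal
        (Supported-⊛ {R = _≡ 2 * (suc n * suc (suc n)) + suc n * (n * 4)} (cong₂ _+_)
          (w-support (suc n)) (Supported-^ (Supported-^ (q^-support 4) n) (suc n)))
        (Supported-⊞ (Supported-const 1ℤ (inj₁ refl))
          (Supported-map inj₂ (Supported-^ (q^-support 4) (suc n))))))
      where
      open ℕ-Solver
      -- With m = n + 1 the two exponents are 2 m (3 m - 1) and 2 m (3 m + 1), and 12 m (3 m ∓ 1) +
      -- 1 = (6 m ∓ 1)².
      pentagonal : ∀ {i j} → i ≡ 2 * (suc n * suc (suc n)) + suc n * (n * 4) →
                   j ≡ 0 ⊎ j ≡ suc n * 4 → Pentagonal (i + j)
      pentagonal refl (inj₁ refl) = 6 * n + 5 ,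
        solve 1 (λ n → con 6 :* (con 2 :* ((con 1 :+ n) :* (con 2 :+ n)) :+
                                 (con 1 :+ n) :* (n :* con 4) :+ con 0) :+ con 1 :=
                       (con 6 :* n :+ con 5) :* (con 6 :* n :+ con 5)) refl n
      pentagonal refl (inj₂ refl) = 6 * n + 7 ,
        solve 1 (λ n → con 6 :* (con 2 :* ((con 1 :+ n) :* (con 2 :+ n)) :+
                                 (con 1 :+ n) :* (n :* con 4) :+ (con 1 :+ n) :* con 4) :+ con 1 :=
                       (con 6 :* n :+ con 7) :* (con 6 :* n :+ con 7)) refl n

  -- The m-th summand is a power of q² with exponent m + m (m - 1) = m².
  gaussTail-support : ∀ n → Supported TwiceSquare (gaussTail (⊝ (q^ 2)) n)
  gaussTail-support zero    = Supported-0
  gaussTail-support (suc n) = Supported-⊞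
    (Supported-⊛ (λ { refl refl → suc n , arith n })
      (Supported-^ (Supported-⊝ (Supported-⊝ (q^-support 2))) (suc n))
      (Supported-^ (Supported-^ (Supported-⊝ (q^-support 2)) n) (suc n)))
    (gaussTail-support n)
    where
    open ℕ-Solver
    arith : ∀ n → suc n * 2 + suc n * (n * 2) ≡ 2 * (suc n * suc n)
    arith = solve 1 (λ n → (con 1 :+ n) :* con 2 :+ (con 1 :+ n) :* (n :* con 2) :=
              con 2 :* ((con 1 :+ n) :* (con 1 :+ n))) refl

  -- Series in q⁴ and the congruence modulo 32.

  Fourfold : Series → Set
  Fourfold = Supported (4 ℕ.∣_)

  Fourfold-⊛ : ∀ {a b} → Fourfold a → Fourfold b → Fourfold (a ⊛ b)
  Fourfold-⊛ = Supported-⊛ ℕ.∣m∣n⇒∣m+n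

  Fourfold-const : ∀ c → Fourfold (const c)
  Fourfold-const c = Supported-const c (4 ℕ.∣0)

  Fourfold-^ : ∀ {a} → Fourfold a → ∀ n → Fourfold (a ^ n)
  Fourfold-^ s zero    = Fourfold-const _
  Fourfold-^ s (suc n) = Fourfold-⊛ s (Fourfold-^ s n)

  Fourfold-∏ : ∀ {t} → (∀ i → Fourfold (t i)) → ∀ n → Fourfold (∏ t n)
  Fourfold-∏ s zero    = Fourfold-const _
  Fourfold-∏ s (suc n) = Fourfold-⊛ (s n) (Fourfold-∏ s n)

  Fourfold-∑ : ∀ {t} → (∀ i → Fourfold (t i)) → ∀ n → Fourfold (∑ t n)
  Fourfold-∑ s zero    = Fourfold-const _
  Fourfold-∑ s (suc n) = Supported-⊞ (s n) (Fourfold-∑ s n)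

  q⁴-fourfold : Fourfold (q^ 4)
  q⁴-fourfold = Supported-map (λ { refl → ℕ.∣-refl }) (q^-support 4)

  K≤K*2 : K ≤ K * 2
  K≤K*2 = ℕ.m≤m*n K 2

  θ-factor : ∀ i → θ (factors⁻ (q^ 4) i) ≈ ⊝ (const (+ 4) ⊛ (κ (+ suc i) ⊛ (q^ 4) ^ suc i))
  θ-factor i = begin
    θ (factors⁻ (q^ 4) i)
      ≈⟨ θ-cong (1-q^≈ 4 i) ⟨
    θ (1-q^ (4 * suc i))
      ≈⟨ ≗⇒≈ (θ-1-q^ (4 * suc i)) ⟩
    ⊝ (const (+ (4 * suc i)) ⊛ (q^ (4 * suc i)))
      ≈⟨ -‿cong (⊛-cong (≗⇒≈ λ n → cong (λ c → const c n) (ℤ.pos-* 4 (suc i))) (q^-* 4 (suc i))) ⟩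
    ⊝ (const (+ 4 ℤ.* + suc i) ⊛ (q^ 4) ^ suc i)
      ≈⟨ -‿cong (*-congʳ {(q^ 4) ^ suc i}
           (≈-trans (_-Raw-AlmostCommutative⟶_.*-homo const-hom (+ 4) (+ suc i))
                    (*-congˡ {const (+ 4)} (≈-sym (κ≈⟦⟧ (+ suc i)))))) ⟩
    ⊝ (const (+ 4) ⊛ κ (+ suc i) ⊛ (q^ 4) ^ suc i)
      ≈⟨ -‿cong (*-assoc (const (+ 4)) (κ (+ suc i)) ((q^ 4) ^ suc i)) ⟩
    ⊝ (const (+ 4) ⊛ (κ (+ suc i) ⊛ (q^ 4) ^ suc i)) ∎

  -- With K factors in q⁴ and K * 2 in q², all products agree with the infinite ones below degree K.
  open Dissection {x = q^ 2} {y = q^ 4} {a = EOᵤ} {f₂ = f 2} {f₄ = f 4} K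
    (≈-trans (q^-* 2 2) (*-congˡ {q^ 2} (*-identityʳ (q^ 2))))
    (^-vanishes {⊝ (q^ 2)} refl K≤K*2)
    (λ i → ^-vanishes {(q^ 4) ^ suc i} refl (ℕ.n≤1+n K))
    (f≈∏ 2 (K * 2) K≤K*2) (f≈∏ 4 K ℕ.≤-refl) (f≈∏ 4 (K * 2) K≤K*2)
    (⊛-cancelʳ (f 4) refl) (≗⇒≈ EOᵤ-defining)
    public using (Q; g; a-mod-32)

  EOᵤ-mod-32 : ∃[ u ] EOᵤ ≈
    f 4 ⊛ Q ⊞ const (+ 2) ⊛ (g ⊛ f 4) ⊞ const (ℤ.- + 2) ⊛ (g ⊛ θ (f 4)) ⊞ const (+ 32) ⊛ u
  EOᵤ-mod-32 = a-mod-32 θ θ-cong (λ a b → ≗⇒≈ (θ-⊛ a b)) θ-1 θ-factor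
    where
    θ-1 : θ (const 1ℤ) ≈ const 0ℤ
    θ-1 = ≗⇒≈ λ { zero → refl ; (suc n) → ℤ.*-zeroʳ (+ suc n) }

  f₄Q-fourfold : Fourfold (f 4 ⊛ Q)
  f₄Q-fourfold = Fourfold-⊛
    (Supported-≈ (f≈∏ 4 K ℕ.≤-refl) (Fourfold-∏ (λ i →
      Supported-⊞ (Fourfold-const 1ℤ) (Supported-⊝ (Fourfold-^ q⁴-fourfold (suc i)))) K))
    (Fourfold-∏ (λ i → Supported-⊞ (Fourfold-const 1ℤ) (Fourfold-⊛ (Fourfold-const (+ 4))
      (Fourfold-∑ (λ k → Fourfold-⊛ (κ-fourfold k)
        (Fourfold-^ (Fourfold-^ q⁴-fourfold (suc i)) (suc k))) K))) K)
    where
    κ-fourfold : ∀ k → Fourfold (κ (+ suc k))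
    κ-fourfold k = Supported-≈ (κ≈⟦⟧ (+ suc k)) (Fourfold-const (+ suc k))

-- Divisibility of a coefficient by 32, and residues modulo 25.

EOᵤ-divisible : ∀ N → ¬ 4 ℕ.∣ N → (∀ s t → 6 * N + 1 ≢ t * t + 12 * (s * s)) → + 32 ∣ EOᵤ N
EOᵤ-divisible m 4∤m unrepresentable = conclude EOᵤ-mod-32
  where
  -- The least truncation that still sees the coefficient of q^m.
  open Truncated (suc m)
  -- If i = 2 s² and 6 j + 1 = t², then 6 (i + j) + 1 = t² + 12 s².
  avoids : ∀ {i j} → TwiceSquare i → Pentagonal j → i + j ≢ m
  avoids {j = j} (s , refl) (t , 6j+1≡t²) refl =
    unrepresentable s t (trans (arith s j) (cong (_+ 12 * (s * s)) 6j+1≡t²))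
    where
    arith : ∀ s j → 6 * (2 * (s * s) + j) + 1 ≡ 6 * j + 1 + 12 * (s * s)
    arith = solve 2 (λ s j → con 6 :* (con 2 :* (s :* s) :+ j) :+ con 1 :=
              con 6 :* j :+ con 1 :+ con 12 :* (s :* s)) refl
      where open ℕ-Solver
  zero-outside : ∀ {P a} → ¬ P m → Supported P a → a m ≡ 0ℤ
  zero-outside ¬Pm s = fromInj₂ (λ Pm → contradiction Pm ¬Pm) (off s m ℕ.≤-refl)
  c⊛g⊛≡0 : ∀ c b → Supported Pentagonal b → (const c ⊛ (g ⊛ b)) m ≡ 0ℤ
  c⊛g⊛≡0 c b s = trans (const-⊛ c (g ⊛ b) m) (trans (cong (c ℤ.*_)
    -- Only the avoidance of m itself matters, so `_≢ m` is taken as the support of the product.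
    (zero-outside {P = _≢ m} {a = g ⊛ b} (λ m≢m → m≢m refl)
      (Supported-⊛ avoids (gaussTail-support (suc m * 2)) s))) (ℤ.*-zeroʳ c))
  0+0+0+ : ∀ {a b c d e} → a ≡ 0ℤ → b ≡ 0ℤ → c ≡ 0ℤ → d ≡ e → a ℤ.+ b ℤ.+ c ℤ.+ d ≡ e
  0+0+0+ refl refl refl refl = ℤ.+-identityˡ _
  conclude : ∃[ u ] EOᵤ ≈
    f 4 ⊛ Q ⊞ const (+ 2) ⊛ (g ⊛ f 4) ⊞ const (ℤ.- + 2) ⊛ (g ⊛ θ (f 4)) ⊞ const (+ 32) ⊛ u →
    + 32 ∣ EOᵤ m
  conclude (u , EOᵤ≈) = subst (λ c → + 32 ∣ c) (sym (trans (at EOᵤ≈ m ℕ.≤-refl)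
      (0+0+0+ {a = (f 4 ⊛ Q) m} {b = (const (+ 2) ⊛ (g ⊛ f 4)) m}
              {c = (const (ℤ.- + 2) ⊛ (g ⊛ θ (f 4))) m} {d = (const (+ 32) ⊛ u) m}
        (zero-outside 4∤m f₄Q-fourfold) (c⊛g⊛≡0 (+ 2) (f 4) f₄-support)
        (c⊛g⊛≡0 (ℤ.- + 2) (θ (f 4)) (Supported-θ f₄-support)) (const-⊛ (+ 32) u m))))
    (subst (32 ℕ.∣_) (sym (ℤ.abs-* (+ 32) (u m))) (ℕ.m∣m*n ℤ.∣ u m ∣))

-- 5 is inert in ℚ(√-3), so 5 divides t² + 12 s² to an even power.
5-exactly-once : List ℕ
5-exactly-once = 5 ∷ 10 ∷ 15 ∷ 20 ∷ []

-- The form depends only on t and s modulo 25, and the 625 pairs of residues are checked by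
-- evaluation.
residues-mod-25 : ∀ t s → ((t * t + 12 * (s * s)) % 25) ∉ 5-exactly-once
residues-mod-25 t s = subst (_∉ 5-exactly-once) (sym reduce)
  (subst₂ (λ a b → ((a * a + 12 * (b * b)) % 25) ∉ 5-exactly-once)
    (Fin.toℕ-fromℕ< (m%n<n t 25)) (Fin.toℕ-fromℕ< (m%n<n s 25))
    (table (fromℕ< (m%n<n t 25)) (fromℕ< (m%n<n s 25))))
  where
  table : (i j : Fin 25) →
    ((toℕ i * toℕ i + 12 * (toℕ j * toℕ j)) % 25) ∉ 5-exactly-once
  table = toWitness {a? = Fin.all? λ i → Fin.all? λ j → ¬? (_ ∈? _)} _
  square : ∀ m → (m * m) % 25 ≡ (m % 25 * (m % 25)) % 25
  square m = %-distribˡ-* m m 25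
  reduce : (t * t + 12 * (s * s)) % 25 ≡ (t % 25 * (t % 25) + 12 * (s % 25 * (s % 25))) % 25
  reduce = begin
    (t * t + 12 * (s * s)) % 25
      ≡⟨ %-distribˡ-+ (t * t) (12 * (s * s)) 25 ⟩
    (t * t % 25 + 12 * (s * s) % 25) % 25
      ≡⟨ cong₂ (λ a b → (a + b) % 25) (square t) (begin
           12 * (s * s) % 25                    ≡⟨ %-distribˡ-* 12 (s * s) 25 ⟩
           (12 * (s * s % 25)) % 25             ≡⟨ cong (λ a → (12 * a) % 25) (square s) ⟩
           (12 * (s % 25 * (s % 25) % 25)) % 25 ≡⟨ %-distribˡ-* 12 (s % 25 * (s % 25)) 25 ⟨
           12 * (s % 25 * (s % 25)) % 25        ∎) ⟩
    (t % 25 * (t % 25) % 25 + 12 * (s % 25 * (s % 25)) % 25) % 25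
      ≡⟨ %-distribˡ-+ (t % 25 * (t % 25)) (12 * (s % 25 * (s % 25))) 25 ⟨
    (t % 25 * (t % 25) + 12 * (s % 25 * (s % 25))) % 25 ∎
    where open ≡-Reasoning

corollary3p2 : ∀ (n r : ℕ) → r ∈ (14 ∷ 34 ∷ 74 ∷ 94 ∷ []) → + 32 ∣ EOᵤ (100 * n + r)
corollary3p2 n r r∈ = EOᵤ-divisible (100 * n + r) 4∤ (λ s t eq →
    residues-mod-25 t s (subst (_∈ 5-exactly-once) (sym (trans (cong (_% 25) (sym eq)) mod-25))
      (lookup (proj₂ residues) r∈)))
  where
  -- For r = 14, 34, 74, 94 the values 6 r + 1 = 85, 205, 445, 565 leave 10, 5, 20, 15 modulo 25.
  residues : All (λ r → r % 4 ≡ 2) (14 ∷ 34 ∷ 74 ∷ 94 ∷ []) ×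
             All (λ r → ((6 * r + 1) % 25) ∈ 5-exactly-once) (14 ∷ 34 ∷ 74 ∷ 94 ∷ [])
  residues = toWitness {a? = all? (λ r → r % 4 ℕ.≟ 2) _} _ , toWitness {a? = all? (λ _ → _ ∈? _) _} _
  mod-4 : (100 * n + r) % 4 ≡ r % 4
  mod-4 = trans (cong (_% 4) (solve 2 (λ n r → con 100 :* n :+ r := r :+ con 25 :* n :* con 4) refl n r))
    ([m+kn]%n≡m%n r (25 * n) 4)
    where open ℕ-Solver
  mod-25 : (6 * (100 * n + r) + 1) % 25 ≡ (6 * r + 1) % 25
  mod-25 = trans (cong (_% 25) (solve 2 (λ n r →
      con 6 :* (con 100 :* n :+ r) :+ con 1 := con 6 :* r :+ con 1 :+ con 24 :* n :* con 25) refl n r))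
    ([m+kn]%n≡m%n (6 * r + 1) (24 * n) 25)
    where open ℕ-Solver
  4∤ : ¬ 4 ℕ.∣ 100 * n + r
  4∤ 4∣ = contradiction (trans (sym (ℕ.n∣m⇒m%n≡0 _ 4 4∣)) (trans mod-4 (lookup (proj₁ residues) r∈))) λ ()
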